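{- Let $n,m$ be positive integers, and let $A_{ij}$ $(i\in[n], j\in[m])$ be $mn$ subsets of the simplex $\Delta^{n-1}$, either all open or all closed (in $\Delta^{n-1}$). Suppose that $A_{ij}$ does not intersect $\partial_i\Delta^{n-1}$ for all $i\in[n]$, $j\in[m]$, and that for every $j\in[m]$ the family $\mathcal A_j=\{A_{ij}\}_{i=1}^n$ is a covering of $\Delta^{n-1}$. Let $a_1,\ldots,a_n$ be positive integers with $\sum_{i=1}^n a_i=m$. Then there exists a map $\sigma:[m]\to[n]$ such that $|\sigma^{ -1}(i)|=a_i$ for all $i\in[n]$ and $$\bigcap_{j=1}^m A_{\sigma(j)j}\neq\emptyset.$$
   Context: $[n]=\{1,2,\ldots,n\}$. $\Delta^{d}$ denotes the $d$-dimensional geometric simplex, whose points are given by barycentric coordinates $(t_1,\ldots,t_{d+1})$ with all $t_i\ge 0$ and $\sum_{i=1}^{d+1}t_i=1$. For $i\in[d+1]$, $\partial_i\Delta^d=\{(t_1,\ldots,t_{d+1})\in\Delta^d: t_i=0\}$ is the $i$-th facet. -}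

module Defs where

open import Data.Fin using (Fin; _≟_)
open import Data.Fin.Subset using (Subset)
open import Data.Nat as ℕ using (ℕ; _⊔_)
import Data.Nat.Properties as ℕₚ
open import Data.Product using (∃-syntax; _×_; _,_; proj₁; proj₂)
open import Data.Rational as ℚ using (ℚ; 0ℚ; 1ℚ; ½)
import Data.Rational.Properties as ℚₚ
open import Data.Rational.Solver using (module +-*-Solver)
open import Data.Sum using (inj₁; inj₂)
open import Data.Vec using (tabulate)
open import Data.Vec.Functional using (Vector; foldr)
open import Level using (Level)
open import Relation.Binary.PropositionalEquality using (_≡_; refl; cong; subst; sym; trans)
open import Relation.Nullary using (does)
open import Relation.Unary using (Pred; _∈_; ∁)

private variable
  ℓ : Level
  m n : ℕ

------------------------------------------------------------------------
-- Real numbers: Cantor's construction, as Cauchy sequences of rationals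
-- considered up to _≈_.

Eventually : Pred ℕ ℓ → Set ℓ
Eventually P = ∃[ N ] (∀ k → N ℕ.≤ k → P k)

IsCauchy : (ℕ → ℚ) → Set
IsCauchy u = ∀ ε → 0ℚ ℚ.< ε →
  ∃[ N ] (∀ j k → N ℕ.≤ j → N ℕ.≤ k → ℚ.∣ u j ℚ.- u k ∣ ℚ.< ε)

record ℝ : Set where
  constructor mkℝ
  field
    seq      : ℕ → ℚ
    isCauchy : IsCauchy seq

open ℝ public

infix 4 _≈_ _≤_ _<_
infixl 6 _+_ _-_

_≈_ : ℝ → ℝ → Set
x ≈ y = ∀ ε → 0ℚ ℚ.< ε → Eventually λ k → ℚ.∣ seq x k ℚ.- seq y k ∣ ℚ.< ε

_≤_ : ℝ → ℝ → Set
x ≤ y = ∀ ε → 0ℚ ℚ.< ε → Eventually λ k → seq x k ℚ.≤ seq y k ℚ.+ ε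

_<_ : ℝ → ℝ → Set
x < y = ∃[ ε ] (0ℚ ℚ.< ε × Eventually λ k → seq x k ℚ.+ ε ℚ.≤ seq y k)

fromℚ : ℚ → ℝ
fromℚ p = mkℝ (λ _ → p) λ ε 0<ε →
  0 , λ _ _ _ _ → subst (λ z → ℚ.∣ z ∣ ℚ.< ε) (sym (ℚₚ.+-inverseʳ p)) 0<ε

0ℝ 1ℝ : ℝ
0ℝ = fromℚ 0ℚ
1ℝ = fromℚ 1ℚ

private
  open +-*-Solver

  0<½ε : ∀ {ε} → 0ℚ ℚ.< ε → 0ℚ ℚ.< ½ ℚ.* ε
  0<½ε {ε} 0<ε = subst (ℚ._< ½ ℚ.* ε) (ℚₚ.*-zeroʳ ½) (ℚₚ.*-monoʳ-<-pos ½ 0<ε)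

  ½ε+½ε : ∀ ε → ½ ℚ.* ε ℚ.+ ½ ℚ.* ε ≡ ε
  ½ε+½ε ε = trans (sym (ℚₚ.*-distribʳ-+ ε ½ ½)) (ℚₚ.*-identityˡ ε)

  interchange : ∀ a b c d → (a ℚ.+ b) ℚ.- (c ℚ.+ d) ≡ (a ℚ.- c) ℚ.+ (b ℚ.- d)
  interchange = solve 4
    (λ a b c d → (a :+ b) :- (c :+ d) := (a :- c) :+ (b :- d)) refl

  split : ∀ a b → a ≡ (a ℚ.- b) ℚ.+ b
  split = solve 2 (λ a b → a := (a :- b) :+ b) refl

  cancelʳ : ∀ a b → (a ℚ.+ b) ℚ.- b ≡ a
  cancelʳ = solve 2 (λ a b → (a :+ b) :- b := a) refl

  neg-minus : ∀ a b → ℚ.- (a ℚ.- b) ≡ b ℚ.- a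
  neg-minus = solve 2 (λ a b → :- (a :- b) := b :- a) refl

  neg-neg-minus : ∀ a b → (ℚ.- a) ℚ.- (ℚ.- b) ≡ ℚ.- (a ℚ.- b)
  neg-neg-minus = solve 2 (λ a b → (:- a) :- (:- b) := :- (a :- b)) refl

  ∣p-q∣≡∣q-p∣ : ∀ p q → ℚ.∣ p ℚ.- q ∣ ≡ ℚ.∣ q ℚ.- p ∣
  ∣p-q∣≡∣q-p∣ p q =
    trans (sym (ℚₚ.∣-p∣≡∣p∣ (p ℚ.- q))) (cong ℚ.∣_∣ (neg-minus p q))

  ∣p∣-∣q∣≤∣p-q∣ : ∀ p q → ℚ.∣ p ∣ ℚ.- ℚ.∣ q ∣ ℚ.≤ ℚ.∣ p ℚ.- q ∣
  ∣p∣-∣q∣≤∣p-q∣ p q = begin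
    ℚ.∣ p ∣ ℚ.- ℚ.∣ q ∣
      ≡⟨ cong (λ z → ℚ.∣ z ∣ ℚ.- ℚ.∣ q ∣) (split p q) ⟩
    ℚ.∣ (p ℚ.- q) ℚ.+ q ∣ ℚ.- ℚ.∣ q ∣
      ≤⟨ ℚₚ.+-monoˡ-≤ (ℚ.- ℚ.∣ q ∣) (ℚₚ.∣p+q∣≤∣p∣+∣q∣ (p ℚ.- q) q) ⟩
    (ℚ.∣ p ℚ.- q ∣ ℚ.+ ℚ.∣ q ∣) ℚ.- ℚ.∣ q ∣
      ≡⟨ cancelʳ ℚ.∣ p ℚ.- q ∣ ℚ.∣ q ∣ ⟩
    ℚ.∣ p ℚ.- q ∣ ∎
    where open ℚₚ.≤-Reasoning

  ∣∣p∣-∣q∣∣≤∣p-q∣ : ∀ p q → ℚ.∣ ℚ.∣ p ∣ ℚ.- ℚ.∣ q ∣ ∣ ℚ.≤ ℚ.∣ p ℚ.- q ∣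
  ∣∣p∣-∣q∣∣≤∣p-q∣ p q with ℚₚ.∣p∣≡p∨∣p∣≡-p (ℚ.∣ p ∣ ℚ.- ℚ.∣ q ∣)
  ... | inj₁ eq = subst (ℚ._≤ ℚ.∣ p ℚ.- q ∣) (sym eq) (∣p∣-∣q∣≤∣p-q∣ p q)
  ... | inj₂ eq = begin
    ℚ.∣ ℚ.∣ p ∣ ℚ.- ℚ.∣ q ∣ ∣  ≡⟨ trans eq (neg-minus ℚ.∣ p ∣ ℚ.∣ q ∣) ⟩
    ℚ.∣ q ∣ ℚ.- ℚ.∣ p ∣        ≤⟨ ∣p∣-∣q∣≤∣p-q∣ q p ⟩
    ℚ.∣ q ℚ.- p ∣              ≡⟨ ∣p-q∣≡∣q-p∣ q p ⟩
    ℚ.∣ p ℚ.- q ∣              ∎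
    where open ℚₚ.≤-Reasoning

_+_ : ℝ → ℝ → ℝ
seq (x + y) k = seq x k ℚ.+ seq y k
isCauchy (x + y) ε 0<ε
  with isCauchy x (½ ℚ.* ε) (0<½ε 0<ε) | isCauchy y (½ ℚ.* ε) (0<½ε 0<ε)
... | M , p | N , q = M ⊔ N , λ j k M⊔N≤j M⊔N≤k → begin-strict
  ℚ.∣ (seq x j ℚ.+ seq y j) ℚ.- (seq x k ℚ.+ seq y k) ∣
    ≡⟨ cong ℚ.∣_∣ (interchange (seq x j) (seq y j) (seq x k) (seq y k)) ⟩
  ℚ.∣ (seq x j ℚ.- seq x k) ℚ.+ (seq y j ℚ.- seq y k) ∣
    ≤⟨ ℚₚ.∣p+q∣≤∣p∣+∣q∣ (seq x j ℚ.- seq x k) (seq y j ℚ.- seq y k) ⟩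
  ℚ.∣ seq x j ℚ.- seq x k ∣ ℚ.+ ℚ.∣ seq y j ℚ.- seq y k ∣
    <⟨ ℚₚ.+-mono-<
         (p j k (ℕₚ.m⊔n≤o⇒m≤o M N M⊔N≤j) (ℕₚ.m⊔n≤o⇒m≤o M N M⊔N≤k))
         (q j k (ℕₚ.m⊔n≤o⇒n≤o M N M⊔N≤j) (ℕₚ.m⊔n≤o⇒n≤o M N M⊔N≤k)) ⟩
  ½ ℚ.* ε ℚ.+ ½ ℚ.* ε
    ≡⟨ ½ε+½ε ε ⟩
  ε ∎
  where open ℚₚ.≤-Reasoning

-_ : ℝ → ℝ
seq (- x) k = ℚ.- seq x k
isCauchy (- x) ε 0<ε with isCauchy x ε 0<ε
... | N , p = N , λ j k N≤j N≤k →
  subst (ℚ._< ε)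
    (sym (trans (cong ℚ.∣_∣ (neg-neg-minus (seq x j) (seq x k)))
                (ℚₚ.∣-p∣≡∣p∣ (seq x j ℚ.- seq x k))))
    (p j k N≤j N≤k)

_-_ : ℝ → ℝ → ℝ
x - y = x + (- y)

∣_∣ : ℝ → ℝ
seq ∣ x ∣ k = ℚ.∣ seq x k ∣
isCauchy ∣ x ∣ ε 0<ε with isCauchy x ε 0<ε
... | N , p = N , λ j k N≤j N≤k →
  ℚₚ.≤-<-trans (∣∣p∣-∣q∣∣≤∣p-q∣ (seq x j) (seq x k)) (p j k N≤j N≤k)

∑ : Vector ℝ n → ℝ
∑ = foldr _+_ 0ℝ

------------------------------------------------------------------------
-- The simplex and its topology

-- Indexed by the number of barycentric coordinates: Simplex n is Δⁿ⁻¹.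
record Simplex (n : ℕ) : Set where
  field
    coord     : Vector ℝ n
    coord≥0   : ∀ i → 0ℝ ≤ coord i
    ∑coord≈1  : ∑ coord ≈ 1ℝ

open Simplex public

∂ : Fin n → Pred (Simplex n) _
∂ i t = coord t i ≈ 0ℝ

-- The sup-metric ball; it induces the Euclidean topology on the simplex.
Ball : Simplex n → ℝ → Pred (Simplex n) _
Ball s ε t = ∀ i → ∣ coord s i - coord t i ∣ < ε

-- Points with coordinatewise ≈ coordinates lie in each other's balls, so an
-- open (or, classically, closed) predicate cannot distinguish them, and it
-- really is a subset of the simplex of real points.
IsOpen : Pred (Simplex n) ℓ → Set ℓ
IsOpen U = ∀ s → s ∈ U → ∃[ ε ] (0ℝ < ε × (∀ t → t ∈ Ball s ε → t ∈ U))

IsClosed : Pred (Simplex n) ℓ → Set ℓ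
IsClosed C = IsOpen (∁ C)

------------------------------------------------------------------------
-- Preimages of points under maps of finite sets

_⁻¹[_] : (Fin m → Fin n) → Fin n → Subset m
σ ⁻¹[ i ] = tabulate λ j → does (σ j ≟ i)

{-# OPTIONS --safe #-}

-- Blowing coordinate i up into a i coordinates reduces the claim to m labels
-- that are each used once.  The cube [0, N]ᵐ⁻¹ carries Kuhn's triangulation and
-- maps to the grid points of the simplex.  The m vertices of each of its cells
-- have consecutive coordinate sums, so these sums mod m assign the m covers
-- bijectively to the vertices of every cell.  Label each vertex by its own
-- cover; Sperner's lemma gives a cell carrying all labels, which is a
-- permutation of covers against labels.  For open sets a Lebesgue number makes
-- one fine grid suffice; for closed sets pass to a limit of finer grids.

module Submission where

open import Defs using (Simplex; ∂; IsOpen; IsClosed; _⁻¹[_])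
open import Defs using (ℝ; mkℝ; seq; isCauchy; fromℚ; ∑; coord; coord≥0; ∑coord≈1; Eventually; IsCauchy)
open import Axiom.ExcludedMiddle using (ExcludedMiddle)
open import Data.Bool using (Bool; true; false; _∧_; _xor_; if_then_else_)
open import Data.Bool.Properties using (∧-zeroʳ; xor-same; ¬-not) renaming (_≟_ to _≟ᵇ_)
open import Data.Bool.Solver using (module xor-∧-Solver)
open import Data.Fin using (Fin; zero; suc; inject₁; fromℕ; punchOut; _≟_)
open import Data.Fin.Permutation using (Permutation; permutation; _⟨$⟩ʳ_)
import Data.Fin.Properties as Finₚ
open import Data.Fin.Subset using (∣_∣)
import Data.Integer as ℤ
import Data.Integer.Properties as ℤₚ
open import Data.List using (List; []; _∷_; _++_; map; concatMap; downFrom; length)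
open import Data.List.Membership.Propositional using (find) renaming (_∈_ to _∈ˡ_)
import Data.List.Properties as Listₚ
open import Data.List.Relation.Unary.All as All using (All; []; _∷_)
import Data.List.Relation.Unary.All.Properties as Allₚ
open import Data.List.Relation.Unary.Any as Any using (Any; here; there)
open import Data.Nat using (ℕ; zero; suc; NonZero; _⊓_; _⊔_; _∸_; _≤_; _<_; _≤?_; _+_; _*_; _%_; _/_; z≤n; s≤s)
open import Data.Nat.Base using (+-0-rawMonoid)
open import Algebra.Definitions.RawMonoid +-0-rawMonoid using (sum)
import Data.Nat.DivMod as DM
import Data.Nat.Properties as ℕₚ
open import Algebra.Properties.CommutativeMonoid.Sum ℕₚ.+-0-commutativeMonoid using (∑-comm; sum-permute; sum-cong-≗; sum-replicate-zero)
open import Algebra.Properties.CommutativeSemigroup ℕₚ.+-commutativeSemigroup using (interchange)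
open import Data.Product using (Σ; Σ-syntax; ∃-syntax; _×_; _,_; proj₁; proj₂)
open import Data.Rational as ℚ using (ℚ; mkℚ; 0ℚ; 1ℚ; ½; 1/_; positive; nonNegative; toℚᵘ)
import Data.Rational.Properties as ℚₚ
open import Data.Rational.Solver using (module +-*-Solver)
import Data.Rational.Unnormalised as ℚᵘ
import Data.Rational.Unnormalised.Properties as ℚᵘₚ
open import Data.Sum using (_⊎_; inj₁; inj₂)
open import Data.Unit using (⊤; tt)
open import Data.Vec as Vec using (Vec; []; _∷_; lookup)
import Data.Vec.Properties as Vecₚ
open import Data.Vec.Functional using (Vector)
open import Function using (_∘_; const; id; Injective)
open import Level using (Level; 0ℓ; Lift; lift)
open import Relation.Binary.PropositionalEquality using (_≡_; _≢_; refl; sym; trans; cong; cong₂; subst; subst₂; module ≡-Reasoning)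
open import Relation.Nullary using (¬_; Dec; yes; no; does; contradiction)
open import Relation.Nullary.Decidable using (dec-false)
open import Relation.Unary using (Pred; _∈_; _∉_; ∁)

-- The map from the cube to the simplex collapses cells: vertices with different coordinate sums can
-- share an image, so a grid point does not determine an owner. Owners and labels therefore live on
-- the vertices of the cube; the image matters only through which coordinates vanish and how far
-- apart two images are. Labels are proper because `A i j` avoids `∂ i`, so its points have nonzero
-- coordinate `i`.
--
-- The parity count behind Sperner's lemma is linear algebra over the field with two elements
-- instead of a pairing of cells along common faces. Simplices are bare vertex lists, a determinant
-- of label indicators detects full labelling, and Stokes' theorem moves the count to the boundary.
--
-- The combinatorial half is constructive. Excluded middle enters in the analysis: in the bisection,
-- for the Lebesgue number, and to decide whether a limit point lies in a given closed set.

private variable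
  ℓ p : Level
  A B : Set
  d k m n r : ℕ

-- Cochains mod 2 on simplices given by their lists of vertices

parity : List A → (A → Bool) → Bool
parity []       G = false
parity (x ∷ xs) G = G x xor parity xs G

parity-cong : {G H : A → Bool} → (∀ x → G x ≡ H x) → ∀ xs → parity xs G ≡ parity xs H
parity-cong G≗H []       = refl
parity-cong G≗H (x ∷ xs) = cong₂ _xor_ (G≗H x) (parity-cong G≗H xs)

parity-false : ∀ {G : A → Bool} {xs} → All (λ x → G x ≡ false) xs → parity xs G ≡ false
parity-false []         = refl
parity-false (px ∷ pxs) = cong₂ _xor_ px (parity-false pxs)

parity-xor : ∀ (G H : A → Bool) xs →
  parity xs (λ x → G x xor H x) ≡ parity xs G xor parity xs H
parity-xor G H []       = refl
parity-xor G H (x ∷ xs) = trans (cong ((G x xor H x) xor_) (parity-xor G H xs))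
  (solve 4 (λ a b c d → (a :+ b) :+ (c :+ d) := (a :+ c) :+ (b :+ d)) refl
    (G x) (H x) (parity xs G) (parity xs H))
  where open xor-∧-Solver

parity-map : ∀ (f : A → B) (G : B → Bool) xs → parity (map f xs) G ≡ parity xs (G ∘ f)
parity-map f G []       = refl
parity-map f G (x ∷ xs) = cong (G (f x) xor_) (parity-map f G xs)

parity-++ : ∀ (G : A → Bool) xs ys → parity (xs ++ ys) G ≡ parity xs G xor parity ys G
parity-++ G []       ys = refl
parity-++ G (x ∷ xs) ys = trans (cong (G x xor_) (parity-++ G xs ys))
  (solve 3 (λ a b c → a :+ (b :+ c) := (a :+ b) :+ c) refl (G x) (parity xs G) (parity ys G))
  where open xor-∧-Solver

parity-concatMap : ∀ (f : A → List B) (G : B → Bool) xs →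
  parity (concatMap f xs) G ≡ parity xs (λ x → parity (f x) G)
parity-concatMap f G []       = refl
parity-concatMap f G (x ∷ xs) =
  trans (parity-++ G (f x) (concatMap f xs)) (cong (parity (f x) G xor_) (parity-concatMap f G xs))

parity-telescope : ∀ (c : ℕ → Bool) n →
  parity (downFrom n) (λ h → c h xor c (suc h)) ≡ c 0 xor c n
parity-telescope c zero    = sym (xor-same (c 0))
parity-telescope c (suc n) = trans (cong ((c n xor c (suc n)) xor_) (parity-telescope c n))
  (solve 3 (λ a b z → (a :+ b) :+ (z :+ a) := z :+ b) refl (c n) (c (suc n)) (c 0))
  where open xor-∧-Solver

parity-true : ∀ (G : A → Bool) xs → parity xs G ≡ true → Any (λ x → G x ≡ true) xs
parity-true G (x ∷ xs) eq with G x in Gx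
... | true  = here Gx
... | false = there (parity-true G xs eq)

-- Summing over the vertices of s mod 2; f = const true gives the coboundary.
contract : (A → Bool) → (List A → Bool) → List A → Bool
contract f G []      = false
contract f G (v ∷ s) = (f v ∧ G s) xor contract f (G ∘ (v ∷_)) s

δ : (List A → Bool) → List A → Bool
δ = contract (const true)

contract-cong : ∀ {f g : A → Bool} {G H : List A → Bool} →
  (∀ v → f v ≡ g v) → (∀ s → G s ≡ H s) → ∀ s → contract f G s ≡ contract g H s
contract-cong f≗g G≗H []      = refl
contract-cong f≗g G≗H (v ∷ s) =
  cong₂ _xor_ (cong₂ _∧_ (f≗g v) (G≗H s)) (contract-cong f≗g (G≗H ∘ (v ∷_)) s)

contract-xorˡ : ∀ (f g : A → Bool) G s →
  contract (λ v → f v xor g v) G s ≡ contract f G s xor contract g G s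
contract-xorˡ f g G []      = refl
contract-xorˡ f g G (v ∷ s) = trans
  (cong (((f v xor g v) ∧ G s) xor_) (contract-xorˡ f g (G ∘ (v ∷_)) s))
  (solve 5 (λ a b c x y → ((a :+ b) :* c) :+ (x :+ y) := (a :* c :+ x) :+ (b :* c :+ y)) refl
    (f v) (g v) (G s) (contract f (G ∘ (v ∷_)) s) (contract g (G ∘ (v ∷_)) s))
  where open xor-∧-Solver

contract-xorʳ : ∀ (f : A → Bool) G H s →
  contract f (λ s → G s xor H s) s ≡ contract f G s xor contract f H s
contract-xorʳ f G H []      = refl
contract-xorʳ f G H (v ∷ s) = trans
  (cong ((f v ∧ (G s xor H s)) xor_) (contract-xorʳ f (G ∘ (v ∷_)) (H ∘ (v ∷_)) s))
  (solve 5 (λ a b c x y → (a :* (b :+ c)) :+ (x :+ y) := (a :* b :+ x) :+ (a :* c :+ y)) refl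
    (f v) (G s) (H s) (contract f (G ∘ (v ∷_)) s) (contract f (H ∘ (v ∷_)) s))
  where open xor-∧-Solver

contract-∧ : ∀ b (f : A → Bool) G s → contract f (λ s → b ∧ G s) s ≡ b ∧ contract f G s
contract-∧ b f G []      = sym (∧-zeroʳ b)
contract-∧ b f G (v ∷ s) = trans
  (cong ((f v ∧ (b ∧ G s)) xor_) (contract-∧ b f (G ∘ (v ∷_)) s))
  (solve 4 (λ b a c x → (a :* (b :* c)) :+ (b :* x) := b :* (a :* c :+ x)) refl
    b (f v) (G s) (contract f (G ∘ (v ∷_)) s))
  where open xor-∧-Solver

contract-map : ∀ (g : A → B) f G s →
  contract f G (map g s) ≡ contract (f ∘ g) (G ∘ map g) s
contract-map g f G []      = refl
contract-map g f G (v ∷ s) = cong ((f (g v) ∧ G (map g s)) xor_) (contract-map g f (G ∘ (g v ∷_)) s)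

contract-vanish : ∀ {P : A → Set p} {f : A → Bool} {G : List A → Bool} →
  (∀ {s} → All P s → G s ≡ false) → ∀ {s} → All P s → contract f G s ≡ false
contract-vanish         G≡0 []               = refl
contract-vanish {f = f} G≡0 {v ∷ s} (pv ∷ ps) = cong₂ _xor_
  (trans (cong (f v ∧_) (G≡0 ps)) (∧-zeroʳ (f v)))
  (contract-vanish (G≡0 ∘ (pv ∷_)) ps)

contract-zero : ∀ {f : A → Bool} {G : List A → Bool} {s} →
  All (λ v → f v ≡ false) s → contract f G s ≡ false
contract-zero []                         = refl
contract-zero {G = G} {s = v ∷ s} (fv ∷ fs) = cong₂ _xor_ (cong (_∧ G s) fv) (contract-zero fs)

private
  -- Splits the double sum by whether `v` is deleted with weight `f`, deleted with weight `g`, or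
  -- kept.
  contract² : ∀ (f g : A → Bool) G v s →
    contract f (contract g G) (v ∷ s) ≡
    (f v ∧ contract g G s) xor ((g v ∧ contract f G s) xor
      contract f (contract g (G ∘ (v ∷_))) s)
  contract² f g G v s = cong ((f v ∧ contract g G s) xor_)
    (trans (contract-xorʳ f (λ s → g v ∧ G s) (contract g (G ∘ (v ∷_))) s)
      (cong (_xor contract f (contract g (G ∘ (v ∷_))) s) (contract-∧ (g v) f G s)))

-- Both sides sum `f v ∧ g w` times the value of `G` after deleting `v` and `w`, over ordered pairs
-- of distinct positions; the order of deletion is immaterial mod 2.
contract-comm : ∀ (f g : A → Bool) G s →
  contract f (contract g G) s ≡ contract g (contract f G) s
contract-comm f g G []      = refl
contract-comm f g G (v ∷ s) = begin
  contract f (contract g G) (v ∷ s)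
    ≡⟨ contract² f g G v s ⟩
  a xor (b xor contract f (contract g (G ∘ (v ∷_))) s)
    ≡⟨ cong (λ c → a xor (b xor c)) (contract-comm f g (G ∘ (v ∷_)) s) ⟩
  a xor (b xor c)
    ≡⟨ solve 3 (λ a b c → a :+ (b :+ c) := b :+ (a :+ c)) refl a b c ⟩
  b xor (a xor c)
    ≡⟨ contract² g f G v s ⟨
  contract g (contract f G) (v ∷ s) ∎
  where
  open ≡-Reasoning
  open xor-∧-Solver
  a = f v ∧ contract g G s
  b = g v ∧ contract f G s
  c = contract g (contract f (G ∘ (v ∷_))) s

-- Every pair of deleted vertices is counted in both orders, and the two equal terms cancel.
contract-nilpotent : ∀ (f : A → Bool) G s → contract f (contract f G) s ≡ false
contract-nilpotent f G []      = refl
contract-nilpotent f G (v ∷ s) = begin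
  contract f (contract f G) (v ∷ s)
    ≡⟨ contract² f f G v s ⟩
  a xor (a xor contract f (contract f (G ∘ (v ∷_))) s)
    ≡⟨ cong (λ c → a xor (a xor c)) (contract-nilpotent f (G ∘ (v ∷_)) s) ⟩
  a xor (a xor false)
    ≡⟨ solve 1 (λ a → a :+ (a :+ con false) := con false) refl a ⟩
  false ∎
  where
  open ≡-Reasoning
  open xor-∧-Solver
  a = f v ∧ contract f G s

-- The determinant mod 2 of the matrix of values of the fs on the vertices of a
-- simplex: for the indicators of the labels it detects fully labelled simplices.
det : Vec (A → Bool) k → List A → Bool
det []       = const true
det (f ∷ fs) = contract f (det fs)

det-map : ∀ (g : A → B) (fs : Vec (B → Bool) k) s →
  det fs (map g s) ≡ det (Vec.map (_∘ g) fs) s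
det-map g []       s = refl
det-map g (f ∷ fs) s =
  trans (contract-map g f (det fs) s) (contract-cong (λ _ → refl) (det-map g fs) s)

det-zero : ∀ (fs : Vec (A → Bool) k) i {s} →
  All (λ v → lookup fs i v ≡ false) s → det fs s ≡ false
det-zero (f ∷ fs) zero    = contract-zero
det-zero (f ∷ fs) (suc i) = contract-vanish (det-zero fs i)

det-true : ∀ (fs : Vec (A → Bool) k) {s} → det fs s ≡ true →
  ∀ i → Any (λ v → lookup fs i v ≡ true) s
det-true fs {s} det≡1 i with Any.any? (λ v → lookup fs i v ≟ᵇ true) s
... | yes p = p
... | no ¬p with () ← trans (sym det≡1) (det-zero fs i (All.map ¬-not (Allₚ.¬Any⇒All¬ s ¬p)))

-- This is a determinant with row `i` occurring twice: the extra copy is commuted down to its twin,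
-- where nilpotency applies.
det-repeat : ∀ (fs : Vec (A → Bool) k) i s → contract (lookup fs i) (det fs) s ≡ false
det-repeat (f ∷ fs) zero    s = contract-nilpotent f (det fs) s
det-repeat (f ∷ fs) (suc i) s = trans (contract-comm (lookup fs i) f (det fs) s)
  (contract-vanish {P = const ⊤} (λ {s} _ → det-repeat fs i s) (All.universal (const tt) s))

total : Vec (A → Bool) k → A → Bool
total []       v = false
total (f ∷ fs) v = f v xor total fs v

contract-total : ∀ (fs : Vec (A → Bool) k) G → (∀ i s → contract (lookup fs i) G s ≡ false) →
  ∀ s → contract (total fs) G s ≡ false
contract-total []       G G≡0 s = contract-zero (All.universal (λ _ → refl) s)
contract-total (f ∷ fs) G G≡0 s = trans (contract-xorˡ f (total fs) G s)
  (cong₂ _xor_ (G≡0 zero s) (contract-total fs G (G≡0 ∘ suc) s))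

-- Adding all other rows to the first one turns it into the constant 1.
det≡δ : ∀ (f : A → Bool) (fs : Vec (A → Bool) k) → (∀ v → total (f ∷ fs) v ≡ true) →
  ∀ s → det (f ∷ fs) s ≡ δ (det fs) s
det≡δ f fs tot≡1 s = begin
  contract f (det fs) s
    ≡⟨ solve 1 (λ a → a := a :+ con false) refl (contract f (det fs) s) ⟩
  contract f (det fs) s xor false
    ≡⟨ cong (contract f (det fs) s xor_) (contract-total fs (det fs) (det-repeat fs) s) ⟨
  contract f (det fs) s xor contract (total fs) (det fs) s
    ≡⟨ contract-xorˡ f (total fs) (det fs) s ⟨
  contract (total (f ∷ fs)) (det fs) s
    ≡⟨ contract-cong tot≡1 (λ _ → refl) s ⟩
  δ (det fs) s ∎
  where
  open ≡-Reasoning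
  open xor-∧-Solver

-- The Kuhn triangulation of the cube

-- The staircase triangulation of s × [h, h+1].
prism : ℕ → List (Vec ℕ d) → List (List (Vec ℕ (suc d)))
prism h []      = []
prism h (y ∷ s) = ((h ∷ y) ∷ map (suc h ∷_) (y ∷ s)) ∷ map ((h ∷ y) ∷_) (prism h s)

-- Dual to ∂(s × I) = s × ∂I + ∂s × I.
prism-boundary : ∀ h (G : List (Vec ℕ (suc d)) → Bool) s → parity (prism h s) (δ G) ≡
  (G (map (h ∷_) s) xor G (map (suc h ∷_) s)) xor δ (λ t → parity (prism h t) G) s
prism-boundary h G [] = solve 1 (λ a → con false := (a :+ a) :+ con false) refl (G [])
  where open xor-∧-Solver
prism-boundary h G (y ∷ s) = begin
  (G (y⁺ ∷ s⁺) xor (G (y⁻ ∷ s⁺) xor δ (λ t → G (y⁻ ∷ y⁺ ∷ t)) s⁺)) xor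
    parity (map (y⁻ ∷_) (prism h s)) (δ G)
    ≡⟨ cong₂ (λ a b → (G (y⁺ ∷ s⁺) xor (G (y⁻ ∷ s⁺) xor a)) xor b)
         (contract-map (suc h ∷_) (const true) (λ t → G (y⁻ ∷ y⁺ ∷ t)) s)
         (trans (parity-map (y⁻ ∷_) (δ G) (prism h s))
           (trans (parity-xor G (δ (G ∘ (y⁻ ∷_))) (prism h s))
             (cong (parity (prism h s) G xor_) (prism-boundary h (G ∘ (y⁻ ∷_)) s)))) ⟩
  (G (y⁺ ∷ s⁺) xor (G (y⁻ ∷ s⁺) xor a)) xor (b xor ((G (y⁻ ∷ s⁻) xor G (y⁻ ∷ s⁺)) xor c))
    ≡⟨ solve 6 (λ x y z a b c → (x :+ (y :+ a)) :+ (b :+ ((z :+ y) :+ c)) :=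
         (z :+ x) :+ (b :+ (a :+ c))) refl
         (G (y⁺ ∷ s⁺)) (G (y⁻ ∷ s⁺)) (G (y⁻ ∷ s⁻)) a b c ⟩
  (G (y⁻ ∷ s⁻) xor G (y⁺ ∷ s⁺)) xor (b xor (a xor c))
    ≡⟨ cong (λ z → (G (y⁻ ∷ s⁻) xor G (y⁺ ∷ s⁺)) xor (b xor z))
         (sym (trans (contract-cong (λ _ → refl) (λ t →
                        cong (G (y⁻ ∷ y⁺ ∷ map (suc h ∷_) t) xor_) (parity-map (y⁻ ∷_) G (prism h t))) s)
                (contract-xorʳ (const true) _ _ s))) ⟩
  (G (y⁻ ∷ s⁻) xor G (y⁺ ∷ s⁺)) xor δ (λ t → parity (prism h t) G) (y ∷ s) ∎
  where
  open ≡-Reasoning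
  open xor-∧-Solver
  y⁻ = h ∷ y
  y⁺ = suc h ∷ y
  s⁻ = map (h ∷_) s
  s⁺ = map (suc h ∷_) s
  a = δ (λ t → G (y⁻ ∷ y⁺ ∷ map (suc h ∷_) t)) s
  b = parity (prism h s) G
  c = δ (λ t → parity (prism h t) (G ∘ (y⁻ ∷_))) s

kuhn : ℕ → ∀ d → List (List (Vec ℕ d))
kuhn N zero    = ([] ∷ []) ∷ []
kuhn N (suc d) = concatMap (λ h → concatMap (prism h) (kuhn N d)) (downFrom N)

-- An interior slice is the top of one layer and the bottom of the next, so only the slices at `0`
-- and `N` survive. The side walls remain as a coboundary on the cube of one dimension less, which
-- opens the way to induction.
kuhn-boundary : ∀ N (G : List (Vec ℕ (suc d)) → Bool) → parity (kuhn N (suc d)) (δ G) ≡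
  (parity (kuhn N d) (G ∘ map (0 ∷_)) xor parity (kuhn N d) (G ∘ map (N ∷_))) xor
  parity (downFrom N) (λ h → parity (kuhn N d) (δ (λ t → parity (prism h t) G)))
kuhn-boundary {d} N G = begin
  parity (kuhn N (suc d)) (δ G)
    ≡⟨ parity-concatMap _ (δ G) (downFrom N) ⟩
  parity (downFrom N) (λ h → parity (concatMap (prism h) (kuhn N d)) (δ G))
    ≡⟨ parity-cong (λ h → trans (parity-concatMap (prism h) (δ G) (kuhn N d))
         (trans (parity-cong (prism-boundary h G) (kuhn N d))
           (trans (parity-xor _ (δ (λ t → parity (prism h t) G)) (kuhn N d))
             (cong (_xor parity (kuhn N d) (δ (λ t → parity (prism h t) G)))
               (parity-xor (G ∘ map (h ∷_)) (G ∘ map (suc h ∷_)) (kuhn N d))))))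
         (downFrom N) ⟩
  parity (downFrom N) (λ h → (slice h xor slice (suc h)) xor sides h)
    ≡⟨ parity-xor _ sides (downFrom N) ⟩
  parity (downFrom N) (λ h → slice h xor slice (suc h)) xor parity (downFrom N) sides
    ≡⟨ cong (_xor parity (downFrom N) sides) (parity-telescope slice N) ⟩
  (slice 0 xor slice N) xor parity (downFrom N) sides ∎
  where
  open ≡-Reasoning
  slice sides : ℕ → Bool
  slice h = parity (kuhn N d) (G ∘ map (h ∷_))
  sides h = parity (kuhn N d) (δ (λ t → parity (prism h t) G))

OnSide : ℕ → List (Vec ℕ d) → Set
OnSide N s = ∃[ i ] (All (λ y → lookup y i ≡ 0) s ⊎ All (λ y → lookup y i ≡ N) s)

prism-All : ∀ {P : Vec ℕ d → Set} {Q : Vec ℕ (suc d) → Set} h →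
  (∀ {y} → P y → Q (h ∷ y)) → (∀ {y} → P y → Q (suc h ∷ y)) →
  ∀ {s} → All P s → All (All Q) (prism h s)
prism-All h bot top []        = []
prism-All h bot top (py ∷ ps) =
  (bot py ∷ Allₚ.map⁺ (All.map top (py ∷ ps))) ∷
  Allₚ.map⁺ (All.map (bot py ∷_) (prism-All h bot top ps))

prism-side : ∀ {N} h {s : List (Vec ℕ d)} → OnSide N s → All (OnSide N) (prism h s)
prism-side h (i , inj₁ ps) = All.map (λ qs → suc i , inj₁ qs) (prism-All h id id ps)
prism-side h (i , inj₂ ps) = All.map (λ qs → suc i , inj₂ qs) (prism-All h id id ps)

-- Stokes for a cochain that vanishes on the boundary of the cube. In dimension zero the only face
-- is the empty simplex, hence the condition on `G []`; for the side walls it holds because the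
-- prism over `[]` is empty.
kuhn-cocycle : ∀ N (G : List (Vec ℕ d) → Bool) → G [] ≡ false →
  (∀ {s} → OnSide N s → G s ≡ false) → parity (kuhn N d) (δ G) ≡ false
kuhn-cocycle {zero}  N G G[] G≡0 = cong (λ b → (b xor false) xor false) G[]
kuhn-cocycle {suc d} N G G[] G≡0 = trans (kuhn-boundary N G) (cong₂ _xor_
  (cong₂ _xor_
    (parity-false (All.universal (λ s → G≡0 (zero , inj₁ (Allₚ.map⁺ (All.universal (λ _ → refl) s)))) (kuhn N d)))
    (parity-false (All.universal (λ s → G≡0 (zero , inj₂ (Allₚ.map⁺ (All.universal (λ _ → refl) s)))) (kuhn N d))))
  (parity-false (All.universal (λ h → kuhn-cocycle N _ refl
    (λ side → parity-false (All.map G≡0 (prism-side h side)))) (downFrom N))))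

-- Maps the cube [0, N]ᵈ onto the simplex of points with coordinate sum N so
-- that the face y_i = 0 goes to the facet x_i = 0, and y_i = N to the facet
-- where the last coordinate vanishes.
greedy : ℕ → Vec ℕ d → Vec ℕ (suc d)
greedy r []       = r ∷ []
greedy r (y ∷ ys) = (r ⊓ y) ∷ greedy (r ∸ y) ys

greedy-zero : ∀ r (y : Vec ℕ d) i → lookup y i ≡ 0 → lookup (greedy r y) (inject₁ i) ≡ 0
greedy-zero r (y ∷ ys) zero    refl = ℕₚ.⊓-zeroʳ r
greedy-zero r (y ∷ ys) (suc i) eq   = greedy-zero (r ∸ y) ys i eq

greedy-empty : ∀ (y : Vec ℕ d) i → lookup (greedy 0 y) i ≡ 0
greedy-empty []       zero    = refl
greedy-empty (y ∷ ys) zero    = refl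
greedy-empty (y ∷ ys) (suc i) =
  trans (cong (λ r → lookup (greedy r ys) i) (ℕₚ.0∸n≡0 y)) (greedy-empty ys i)

greedy-full : ∀ r (y : Vec ℕ d) i → r ≤ lookup y i → lookup (greedy r y) (fromℕ d) ≡ 0
greedy-full r (y ∷ ys) zero    r≤y =
  trans (cong (λ r → lookup (greedy r ys) (fromℕ _)) (ℕₚ.m≤n⇒m∸n≡0 r≤y)) (greedy-empty ys (fromℕ _))
greedy-full r (y ∷ ys) (suc i) r≤y = greedy-full (r ∸ y) ys i (ℕₚ.≤-trans (ℕₚ.m∸n≤m r y) r≤y)

private
  total-map : ∀ (g : A → B) (fs : Vec (B → Bool) k) v → total (Vec.map (_∘ g) fs) v ≡ total fs (g v)
  total-map g []       v = refl
  total-map g (f ∷ fs) v = cong (f (g v) xor_) (total-map g fs v)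

  lookup-map : ∀ (g : A → B) (fs : Vec (B → Bool) k) i v → lookup (Vec.map (_∘ g) fs) i v ≡ lookup fs i (g v)
  lookup-map g (f ∷ fs) zero    v = refl
  lookup-map g (f ∷ fs) (suc i) v = lookup-map g fs i v

-- Sperner's lemma with labels replaced by functions summing to 1.  By Stokes the
-- determinant is counted on the boundary without its first row, and all facets
-- except the one where the first coordinate is 0 miss some other row.
kuhn-det : ∀ N (fs : Vec (Vec ℕ d → Bool) (suc d)) → (∀ y → total fs y ≡ true) →
  (∀ y i → lookup (greedy N y) i ≡ 0 → lookup fs i y ≡ false) →
  parity (kuhn N d) (det fs) ≡ true
kuhn-det {zero} N (f ∷ []) tot≡1 supp with f [] | tot≡1 []
... | true | _ = refl
kuhn-det {suc d} N (f ∷ fs) tot≡1 supp = begin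
  parity (kuhn N (suc d)) (det (f ∷ fs))
    ≡⟨ parity-cong (det≡δ f fs tot≡1) (kuhn N (suc d)) ⟩
  parity (kuhn N (suc d)) (δ (det fs))
    ≡⟨ kuhn-boundary N (det fs) ⟩
  (parity (kuhn N d) (det fs ∘ map (0 ∷_)) xor parity (kuhn N d) (det fs ∘ map (N ∷_))) xor
    parity (downFrom N) (λ h → parity (kuhn N d) (δ (λ t → parity (prism h t) (det fs))))
    ≡⟨ cong₂ _xor_ (cong₂ _xor_ bottom top) sides ⟩
  true ∎
  where
  open ≡-Reasoning
  f0≡0 : ∀ y → f (0 ∷ y) ≡ false
  f0≡0 y = supp (0 ∷ y) zero (ℕₚ.⊓-zeroʳ N)
  -- On this facet `f` vanishes, so the remaining rows still sum to 1, and `greedy` merely prepends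
  -- a zero: the hypotheses hold one dimension lower.
  bottom : parity (kuhn N d) (det fs ∘ map (0 ∷_)) ≡ true
  bottom = trans (parity-cong (det-map (0 ∷_) fs) (kuhn N d))
    (kuhn-det N (Vec.map (_∘ (0 ∷_)) fs)
      (λ y → trans (total-map (0 ∷_) fs y)
        (trans (cong (_xor total fs (0 ∷ y)) (sym (f0≡0 y))) (tot≡1 (0 ∷ y))))
      (λ y i eq → trans (lookup-map (0 ∷_) fs i y) (supp (0 ∷ y) (suc i) eq)))
  full : ∀ i {s} → All (λ y → lookup y i ≡ N) s → det fs s ≡ false
  full i = det-zero fs (fromℕ d) ∘
    All.map (λ {y} eq → supp y (fromℕ (suc d)) (greedy-full N y i (ℕₚ.≤-reflexive (sym eq))))
  empty : ∀ i {s} → All (λ y → lookup y (suc i) ≡ 0) s → det fs s ≡ false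
  empty i = det-zero fs (inject₁ i) ∘
    All.map (λ {y} eq → supp y (suc (inject₁ i)) (greedy-zero N y (suc i) eq))
  top : parity (kuhn N d) (det fs ∘ map (N ∷_)) ≡ false
  top = parity-false (All.universal
    (λ s → full zero (Allₚ.map⁺ (All.universal (λ _ → refl) s))) (kuhn N d))
  side : ∀ h {s} → OnSide N s → parity (prism h s) (det fs) ≡ false
  side h (i , inj₁ ps) = parity-false (All.map (empty i) (prism-All h id id ps))
  side h (i , inj₂ ps) = parity-false (All.map (full (suc i)) (prism-All h id id ps))
  sides : parity (downFrom N) (λ h → parity (kuhn N d) (δ (λ t → parity (prism h t) (det fs)))) ≡ false
  sides = parity-false (All.universal (λ h → kuhn-cocycle N _ refl (side h)) (downFrom N))

-- Sperner's lemma with owners and multiplicities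

total-indicator : ∀ (fs : Fin k → A → Bool) (x : Fin k) v → (∀ i → fs i v ≡ does (x ≟ i)) →
  total (Vec.tabulate fs) v ≡ true
total-indicator fs zero    v eq = cong₂ _xor_ (eq zero) (none (fs ∘ suc) (eq ∘ suc))
  where
  none : ∀ {k} (gs : Fin k → _ → Bool) → (∀ i → gs i v ≡ false) → total (Vec.tabulate gs) v ≡ false
  none {zero}  gs gs≡0 = refl
  none {suc k} gs gs≡0 = cong₂ _xor_ (gs≡0 zero) (none (gs ∘ suc) (gs≡0 ∘ suc))
total-indicator fs (suc x) v eq = cong₂ _xor_ (eq zero) (total-indicator (fs ∘ suc) x v (eq ∘ suc))

does-true : ∀ {P : Set p} (P? : Dec P) → does P? ≡ true → P
does-true (yes p) _ = p

sperner : ∀ N (L : Vec ℕ d → Fin (suc d)) → (∀ y → lookup (greedy N y) (L y) ≢ 0) →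
  ∃[ s ] (s ∈ˡ kuhn N d × ∀ i → Any (λ y → L y ≡ i) s)
sperner {d} N L proper =
  let s , s∈ , det≡1 = find (parity-true (det fs) (kuhn N d) (kuhn-det N fs tot supp))
  in s , s∈ , λ i → Any.map (λ {y} eq →
       does-true (L y ≟ i) (trans (sym (at i y)) eq)) (det-true fs det≡1 i)
  where
  f : Fin (suc d) → Vec ℕ d → Bool
  f i y = does (L y ≟ i)
  fs = Vec.tabulate f
  at : ∀ i y → lookup fs i y ≡ f i y
  at i y = cong (λ g → g y) (Vecₚ.lookup∘tabulate f i)
  tot : ∀ y → total fs y ≡ true
  tot y = total-indicator f (L y) y (λ _ → refl)
  supp : ∀ y i → lookup (greedy N y) i ≡ 0 → lookup fs i y ≡ false
  supp y i eq = trans (at i y) (dec-false (L y ≟ i) λ { refl → proper y eq })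

-- Coordinate sums and diameter of the cells

Rising : ℕ → List (Vec ℕ d) → Set
Rising t []      = ⊤
Rising t (y ∷ s) = Vec.sum y ≡ t × Rising (suc t) s

map-rising : ∀ h t {s : List (Vec ℕ d)} → Rising t s → Rising (h + t) (map (h ∷_) s)
map-rising h t {[]}    _        = tt
map-rising h t {y ∷ s} (eq , ρ) =
  cong (h +_) eq , subst (λ z → Rising z (map (h ∷_) s)) (ℕₚ.+-suc h t) (map-rising h (suc t) ρ)

-- The list stays at height `h` until one vertex is repeated at height `suc h`. At that repetition
-- only the new coordinate grows, at all other steps only the old ones do, so each step adds one.
prism-rising : ∀ h t {s : List (Vec ℕ d)} → Rising t s → All (Rising (h + t)) (prism h s)
prism-rising h t {[]}    _        = []
prism-rising h t {y ∷ s} (eq , ρ) =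
  (cong (h +_) eq , map-rising (suc h) t {y ∷ s} (eq , ρ)) ∷
  Allₚ.map⁺ (All.map (λ {q} ρ′ → cong (h +_) eq , subst (λ z → Rising z q) (ℕₚ.+-suc h t) ρ′)
    (prism-rising h (suc t) ρ))

rising-≥ : ∀ t {s : List (Vec ℕ d)} → Rising t s → ∀ {y} → y ∈ˡ s → t ≤ Vec.sum y
rising-≥ t (refl , ρ) (here refl) = ℕₚ.≤-refl
rising-≥ t (_ , ρ)    (there y∈)  = ℕₚ.<⇒≤ (rising-≥ (suc t) ρ y∈)

rising-< : ∀ t {s : List (Vec ℕ d)} → Rising t s → ∀ {y} → y ∈ˡ s → Vec.sum y < t + length s
rising-< t (refl , ρ) (here refl) = ℕₚ.m<m+n t (s≤s z≤n)
rising-< t {_ ∷ s} (_ , ρ) {y} (there y∈) =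
  subst (Vec.sum y <_) (sym (ℕₚ.+-suc t (length s))) (rising-< (suc t) ρ y∈)

rising-injective : ∀ t {s : List (Vec ℕ d)} → Rising t s → ∀ {y z} → y ∈ˡ s → z ∈ˡ s →
  Vec.sum y ≡ Vec.sum z → y ≡ z
rising-injective t (refl , ρ) (here refl) (here refl) _  = refl
rising-injective t (refl , ρ) (here refl) (there z∈)  eq =
  contradiction (rising-≥ (suc t) ρ z∈) (ℕₚ.≤⇒≯ (ℕₚ.≤-reflexive (sym eq)))
rising-injective t (refl , ρ) (there y∈)  (here refl) eq =
  contradiction (rising-≥ (suc t) ρ y∈) (ℕₚ.≤⇒≯ (ℕₚ.≤-reflexive eq))
rising-injective t (_ , ρ)    (there y∈)  (there z∈)  eq = rising-injective (suc t) ρ y∈ z∈ eq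

-- With equal remainders, a larger quotient costs at least a full `m` and would leave the window of
-- length `m`.
%-injective : ∀ t m .{{_ : NonZero m}} {a b} → t ≤ a → a < t + m → t ≤ b → b < t + m →
  a % m ≡ b % m → a ≡ b
%-injective t m {a} {b} t≤a a< t≤b b< eq =
  ℕₚ.≤-antisym (bound {b} {a} t≤b a< eq) (bound {a} {b} t≤a b< (sym eq))
  where
  open ℕₚ.≤-Reasoning
  bound : ∀ {b a} → t ≤ b → a < t + m → a % m ≡ b % m → a ≤ b
  bound {b} {a} t≤b a< eq with a / m ≤? b / m
  ... | yes q≤ = begin
    a                   ≡⟨ DM.m≡m%n+[m/n]*n a m ⟩
    a % m + a / m * m   ≤⟨ ℕₚ.+-mono-≤ (ℕₚ.≤-reflexive eq) (ℕₚ.*-monoˡ-≤ m q≤) ⟩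
    b % m + b / m * m   ≡⟨ DM.m≡m%n+[m/n]*n b m ⟨
    b                   ∎
  ... | no  q≰ = contradiction a< (ℕₚ.≤⇒≯ (begin
    t + m                    ≤⟨ ℕₚ.+-monoˡ-≤ m t≤b ⟩
    b + m                    ≡⟨ cong (_+ m) (DM.m≡m%n+[m/n]*n b m) ⟩
    b % m + b / m * m + m    ≡⟨ ℕₚ.+-assoc (b % m) (b / m * m) m ⟩
    b % m + (b / m * m + m)  ≡⟨ cong (b % m +_) (ℕₚ.+-comm (b / m * m) m) ⟩
    b % m + suc (b / m) * m  ≤⟨ ℕₚ.+-mono-≤ (ℕₚ.≤-reflexive (sym eq)) (ℕₚ.*-monoˡ-≤ m (ℕₚ.≰⇒> q≰)) ⟩
    a % m + a / m * m        ≡⟨ DM.m≡m%n+[m/n]*n a m ⟨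
    a                        ∎))

InCube : Vec ℕ d → Vec ℕ d → Set
InCube z y = ∀ i → lookup z i ≤ lookup y i × lookup y i ≤ suc (lookup z i)

prism-inCube : ∀ h {z} {s : List (Vec ℕ d)} → All (InCube z) s → All (All (InCube (h ∷ z))) (prism h s)
prism-inCube h = prism-All h
  (λ near → λ { zero → ℕₚ.≤-refl , ℕₚ.n≤1+n h ; (suc i) → near i })
  (λ near → λ { zero → ℕₚ.n≤1+n h , ℕₚ.≤-refl ; (suc i) → near i })

prism-length : ∀ h (s : List (Vec ℕ d)) → All (λ q → length q ≡ suc (length s)) (prism h s)
prism-length h []      = []
prism-length h (y ∷ s) =
  cong (λ l → suc (suc l)) (Listₚ.length-map (suc h ∷_) s) ∷ Allₚ.map⁺ (All.map (cong suc) (prism-length h s))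

Cell : List (Vec ℕ d) → Set
Cell {d} s = length s ≡ suc d × ∃[ t ] Rising t s × ∃[ z ] All (InCube z) s

kuhn-cells : ∀ N d → All Cell (kuhn N d)
kuhn-cells N zero    = (refl , 0 , (refl , tt) , [] , (λ ()) ∷ []) ∷ []
kuhn-cells N (suc d) = Allₚ.concat⁺ (Allₚ.map⁺ (All.universal (λ h →
  Allₚ.concat⁺ (Allₚ.map⁺ (All.map (λ {s} → prism-cells h s) (kuhn-cells N d)))) (downFrom N)))
  where
  prism-cells : ∀ h s → Cell s → All Cell (prism h s)
  prism-cells h s (len , t , ρ , z , near) = All.map
    (λ ((len′ , ρ′) , near′) → trans len′ (cong suc len) , h + t , ρ′ , h ∷ z , near′)
    (All.zip (All.zip (prism-length h s , prism-rising h t ρ) , prism-inCube h near))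

∸-near : ∀ {r r′ y y′ e} → r ≤ r′ + e → y′ ≤ suc y → r ∸ y ≤ r′ ∸ y′ + suc e
∸-near {r} {r′} {y} {y′} {e} r≤ y′≤ = ℕₚ.m≤n+o⇒m∸n≤o r y (begin
  r                         ≤⟨ r≤ ⟩
  r′ + e                    ≤⟨ ℕₚ.+-monoˡ-≤ e (ℕₚ.m≤n+m∸n r′ y′) ⟩
  y′ + (r′ ∸ y′) + e        ≤⟨ ℕₚ.+-monoˡ-≤ e (ℕₚ.+-monoˡ-≤ (r′ ∸ y′) y′≤) ⟩
  suc (y + (r′ ∸ y′) + e)   ≡⟨ cong suc (ℕₚ.+-assoc y (r′ ∸ y′) e) ⟩
  suc (y + (r′ ∸ y′ + e))   ≡⟨ ℕₚ.+-suc y _ ⟨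
  y + suc (r′ ∸ y′ + e)     ≡⟨ cong (y +_) (ℕₚ.+-suc (r′ ∸ y′) e) ⟨
  y + (r′ ∸ y′ + suc e)     ∎)
  where open ℕₚ.≤-Reasoning

-- `e` bounds the drift between the two remainders. Each coordinate consumed adds at most one to it
-- while `d` drops by one, so `suc (e + d)` is a bound that the recursion preserves.
greedy-near : ∀ e {r r′} (y y′ : Vec ℕ d) → r ≤ r′ + e → r′ ≤ r + e →
  (∀ i → lookup y i ≤ suc (lookup y′ i)) → (∀ i → lookup y′ i ≤ suc (lookup y i)) →
  ∀ i → lookup (greedy r y) i ≤ lookup (greedy r′ y′) i + suc (e + d)
greedy-near e {r} {r′} [] [] r≤ _ _ _ zero =
  ℕₚ.≤-trans r≤ (ℕₚ.+-monoʳ-≤ r′ (ℕₚ.≤-trans (ℕₚ.m≤m+n e 0) (ℕₚ.n≤1+n _)))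
greedy-near {suc d} e {r} {r′} (y ∷ ys) (y′ ∷ ys′) r≤ r′≤ y≤ y′≤ zero = begin
  r ⊓ y                             ≤⟨ ℕₚ.⊓-mono-≤ (ℕₚ.≤-trans r≤ (ℕₚ.+-monoʳ-≤ r′ e≤K)) y≤K ⟩
  (r′ + K) ⊓ (y′ + K)               ≡⟨ ℕₚ.+-distribʳ-⊓ K r′ y′ ⟨
  r′ ⊓ y′ + K                       ∎
  where
  open ℕₚ.≤-Reasoning
  K = suc (e + suc d)
  e≤K : e ≤ K
  e≤K = ℕₚ.≤-trans (ℕₚ.m≤m+n e (suc d)) (ℕₚ.n≤1+n _)
  y≤K : y ≤ y′ + K
  y≤K = ℕₚ.≤-trans (y≤ zero)
    (ℕₚ.≤-trans (ℕₚ.≤-reflexive (ℕₚ.+-comm 1 y′)) (ℕₚ.+-monoʳ-≤ y′ (s≤s z≤n)))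
greedy-near {suc d} e {r} {r′} (y ∷ ys) (y′ ∷ ys′) r≤ r′≤ y≤ y′≤ (suc i) = subst
  (λ K → lookup (greedy (r ∸ y) ys) i ≤ lookup (greedy (r′ ∸ y′) ys′) i + suc K) (sym (ℕₚ.+-suc e d))
  (greedy-near (suc e) ys ys′ (∸-near r≤ (y′≤ zero)) (∸-near r′≤ (y≤ zero)) (y≤ ∘ suc) (y′≤ ∘ suc) i)

greedy-sum : ∀ r (y : Vec ℕ d) → sum (lookup (greedy r y)) ≡ r
greedy-sum r []       = ℕₚ.+-identityʳ r
greedy-sum r (y ∷ ys) = trans (cong (r ⊓ y +_) (greedy-sum (r ∸ y) ys))
  (trans (cong (_+ (r ∸ y)) (ℕₚ.⊓-comm r y)) (ℕₚ.m⊓n+n∸m≡n y r))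

Grid : ℕ → ℕ → Set
Grid N n = Σ (Vector ℕ n) λ x → sum x ≡ N

injective⇒surjective : ∀ (f : Fin m → Fin m) → Injective _≡_ _≡_ f → ∀ j → ∃[ i ] (f i ≡ j)
injective⇒surjective {suc m} f inj j with Finₚ.any? (λ i → f i ≟ j)
... | yes hit  = hit
... | no  miss = contradiction
  (Finₚ.injective⇒≤ {f = λ i → punchOut (avoid i)} (inj ∘ Finₚ.punchOut-injective (avoid _) (avoid _)))
  ℕₚ.1+n≰n
  where
  avoid : ∀ i → j ≢ f i
  avoid i eq = miss (i , sym eq)

colourful-sperner : ∀ N (Λ : Fin (suc d) → Grid N (suc d) → Fin (suc d)) →
  (∀ j x → proj₁ x (Λ j x) ≢ 0) →
  Σ[ π ∈ Permutation (suc d) (suc d) ] Σ[ w ∈ (Fin (suc d) → Grid N (suc d)) ]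
    ((∀ j → Λ j (w j) ≡ π ⟨$⟩ʳ j) × (∀ j j′ i → proj₁ (w j) i ≤ proj₁ (w j′) i + suc d))
colourful-sperner {d} N Λ proper = permutation τ q τ∘q q∘τ , w , label , near
  where
  owner : Vec ℕ d → Fin (suc d)
  owner y = Vec.sum y DM.mod suc d
  γ : Vec ℕ d → Grid N (suc d)
  γ y = lookup (greedy N y) , greedy-sum N y
  found = sperner N (λ y → Λ (owner y) (γ y)) (λ y → proper (owner y) (γ y))
  s = proj₁ found
  cell = All.lookup (kuhn-cells N d) (proj₁ (proj₂ found))
  v : Fin (suc d) → Vec ℕ d
  v i = proj₁ (find (proj₂ (proj₂ found) i))
  v∈s : ∀ i → v i ∈ˡ s
  v∈s i = proj₁ (proj₂ (find (proj₂ (proj₂ found) i)))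
  v-label : ∀ i → Λ (owner (v i)) (γ (v i)) ≡ i
  v-label i = proj₂ (proj₂ (find (proj₂ (proj₂ found) i)))
  owner-injective : ∀ {y z} → y ∈ˡ s → z ∈ˡ s → owner y ≡ owner z → y ≡ z
  owner-injective {y} {z} y∈ z∈ eq with len , t , ρ , _ ← cell =
    rising-injective t ρ y∈ z∈ (%-injective t (suc d)
      (rising-≥ t ρ y∈) (subst (λ l → Vec.sum y < t + l) len (rising-< t ρ y∈))
      (rising-≥ t ρ z∈) (subst (λ l → Vec.sum z < t + l) len (rising-< t ρ z∈))
      (Finₚ.fromℕ<-injective _ _ _ _ eq))
  -- `q` sends a label to the cover that assigned it. In the cell the owner determines the vertex
  -- and the vertex its label, so `q` is injective, hence bijective; its inverse `τ` is the
  -- permutation sought.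
  q : Fin (suc d) → Fin (suc d)
  q = owner ∘ v
  q-injective : Injective _≡_ _≡_ q
  q-injective {i} {i′} eq = trans (sym (v-label i))
    (trans (cong (λ y → Λ (owner y) (γ y)) (owner-injective (v∈s i) (v∈s i′) eq)) (v-label i′))
  τ : Fin (suc d) → Fin (suc d)
  τ j = proj₁ (injective⇒surjective q q-injective j)
  q∘τ : ∀ j → q (τ j) ≡ j
  q∘τ j = proj₂ (injective⇒surjective q q-injective j)
  τ∘q : ∀ i → τ (q i) ≡ i
  τ∘q i = q-injective (q∘τ (q i))
  w : Fin (suc d) → Grid N (suc d)
  w j = γ (v (τ j))
  label : ∀ j → Λ j (w j) ≡ τ j
  label j = trans (cong (λ o → Λ o (w j)) (sym (q∘τ j))) (v-label (τ j))
  v-near : ∀ i i′ l → lookup (v i) l ≤ suc (lookup (v i′) l)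
  v-near i i′ l with _ , _ , _ , _ , inCube ← cell =
    ℕₚ.≤-trans (proj₂ (All.lookup inCube (v∈s i) l)) (s≤s (proj₁ (All.lookup inCube (v∈s i′) l)))
  near : ∀ j j′ i → proj₁ (w j) i ≤ proj₁ (w j′) i + suc d
  near j j′ = greedy-near 0 (v (τ j)) (v (τ j′)) (ℕₚ.m≤m+n N 0) (ℕₚ.m≤m+n N 0)
    (v-near (τ j) (τ j′)) (v-near (τ j′) (τ j))

-- Multiplicities by merging coordinates

χ : Fin n → Fin n → ℕ
χ i x = if does (x ≟ i) then 1 else 0

∣⁻¹∣≡sum : ∀ (σ : Fin m → Fin n) i → ∣ σ ⁻¹[ i ] ∣ ≡ sum (χ i ∘ σ)
∣⁻¹∣≡sum {zero}  σ i = refl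
∣⁻¹∣≡sum {suc m} σ i with does (σ zero ≟ i)
... | true  = cong suc (∣⁻¹∣≡sum (σ ∘ suc) i)
... | false = ∣⁻¹∣≡sum (σ ∘ suc) i

block : ∀ k → (Fin r → Fin n) → Fin (k + r) → Fin (suc n)
block zero    b p       = suc (b p)
block (suc k) b zero    = zero
block (suc k) b (suc p) = block k b p

block-zero : ∀ k (b : Fin r → Fin n) → sum (χ zero ∘ block k b) ≡ k
block-zero {r} zero    b = sum-replicate-zero r
block-zero     (suc k) b = cong suc (block-zero k b)

block-suc : ∀ k (b : Fin r → Fin n) i → sum (χ (suc i) ∘ block k b) ≡ sum (χ i ∘ b)
block-suc zero    b i = refl
block-suc (suc k) b i = block-suc k b i

-- The weakly increasing map with `a i` elements over each `i`.
blocks : ∀ (a : Fin n → ℕ) → Fin (sum a) → Fin n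
blocks {suc n} a = block (a zero) (blocks (a ∘ suc))

sum-blocks : ∀ (a : Fin n → ℕ) i → sum (χ i ∘ blocks a) ≡ a i
sum-blocks a zero    = block-zero (a zero) (blocks (a ∘ suc))
sum-blocks a (suc i) = trans (block-suc (a zero) (blocks (a ∘ suc)) i) (sum-blocks (a ∘ suc) i)

sum-χ : ∀ (x : Fin n) (k : ℕ) → sum (λ i → if does (x ≟ i) then k else 0) ≡ k
sum-χ {suc n} zero    k = trans (cong (k +_) (sum-replicate-zero n)) (ℕₚ.+-identityʳ k)
sum-χ {suc n} (suc x) k = sum-χ x k

sum-near : ∀ (f g : Vector ℕ m) K → (∀ p → f p ≤ g p + K) → sum f ≤ sum g + m * K
sum-near {zero}  f g K f≤g = z≤n
sum-near {suc m} f g K f≤g = begin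
  f zero + sum (f ∘ suc)                      ≤⟨ ℕₚ.+-mono-≤ (f≤g zero) (sum-near (f ∘ suc) (g ∘ suc) K (f≤g ∘ suc)) ⟩
  (g zero + K) + (sum (g ∘ suc) + m * K)      ≡⟨ interchange (g zero) K (sum (g ∘ suc)) (m * K) ⟩
  (g zero + sum (g ∘ suc)) + (K + m * K)      ∎
  where
  open ℕₚ.≤-Reasoning

sum≢0 : ∀ (f : Vector ℕ m) → sum f ≢ 0 → ∃[ p ] (f p ≢ 0)
sum≢0 {zero}  f s≢0 = contradiction refl s≢0
sum≢0 {suc m} f s≢0 with f zero in eq
... | suc _ = zero , λ f0≡0 → contradiction (trans (sym eq) f0≡0) λ ()
... | zero  with p , fp≢0 ← sum≢0 (f ∘ suc) s≢0 = suc p , fp≢0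

module _ (b : Fin m → Fin n) where

  -- The simplicial map induced by `b`: coordinates over the same `i` are added up.
  push : Vector ℕ m → Vector ℕ n
  push x i = sum λ p → if does (b p ≟ i) then x p else 0

  sum-push : ∀ x → sum (push x) ≡ sum x
  sum-push x = trans (∑-comm λ i p → if does (b p ≟ i) then x p else 0)
    (sum-cong-≗ λ p → sum-χ (b p) (x p))

  push-near : ∀ {x y} K → (∀ p → x p ≤ y p + K) → ∀ i → push x i ≤ push y i + m * K
  push-near {x} {y} K x≤y i = sum-near _ _ K λ p → step (does (b p ≟ i)) (x≤y p)
    where
    step : ∀ c {x y} → x ≤ y + K → (if c then x else 0) ≤ (if c then y else 0) + K
    step true  x≤ = x≤
    step false x≤ = z≤n

  -- Lifts a proper label `i` of the merged point to a proper label `p` over it.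
  push≢0 : ∀ x {i} → push x i ≢ 0 → ∃[ p ] (b p ≡ i × x p ≢ 0)
  push≢0 x {i} px≢0 with sum≢0 (λ p → if does (b p ≟ i) then x p else 0) px≢0
  ... | p , xp≢0 with b p ≟ i
  ... | yes bp≡i = p , bp≡i , xp≢0
  ... | no  _    = contradiction refl xp≢0

abstract

  -- The lifted labels form a permutation, and composing `b` with it keeps the fibre sizes. One
  -- factor `suc d` of the bound is the spread of a cell, the other the number of coordinates that
  -- may be merged.
  sperner-with-multiplicities : ∀ (a : Fin n → ℕ) → suc d ≡ sum a → ∀ N
    (Λ : Fin (suc d) → Grid N n → Fin n) → (∀ j (x : Grid N n) → proj₁ x (Λ j x) ≢ 0) →
    Σ[ σ ∈ (Fin (suc d) → Fin n) ] ((∀ i → ∣ σ ⁻¹[ i ] ∣ ≡ a i) × Σ[ w ∈ (Fin (suc d) → Grid N n) ]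
      ((∀ j → Λ j (w j) ≡ σ j) × (∀ j j′ i → proj₁ (w j) i ≤ proj₁ (w j′) i + suc d * suc d)))
  sperner-with-multiplicities {n} {d} a d≡ N Λ proper =
    let π , w , label , near = colourful-sperner N Λ′ (λ j x → proj₂ (proj₂ (refinement j x)))
    in b ∘ (π ⟨$⟩ʳ_) , card π , (β ∘ w) ,
       (λ j → trans (sym (b∘Λ′ j (w j))) (cong b (label j))) ,
       λ j j′ → push-near b (suc d) (near j j′)
    where
    b : Fin (suc d) → Fin n
    b = subst (λ k → Fin k → Fin n) (sym d≡) (blocks a)
    sum-b : ∀ {k} (eq : k ≡ sum a) i → sum (χ i ∘ subst (λ k → Fin k → Fin n) (sym eq) (blocks a)) ≡ a i
    sum-b refl = sum-blocks a
    β : Grid N (suc d) → Grid N n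
    β (x , eq) = push b x , trans (sum-push b x) eq
    refinement : ∀ j (x : Grid N (suc d)) → ∃[ p ] (b p ≡ Λ j (β x) × proj₁ x p ≢ 0)
    refinement j x = push≢0 b (proj₁ x) (proper j (β x))
    Λ′ : Fin (suc d) → Grid N (suc d) → Fin (suc d)
    Λ′ j x = proj₁ (refinement j x)
    b∘Λ′ : ∀ j x → b (Λ′ j x) ≡ Λ j (β x)
    b∘Λ′ j x = proj₁ (proj₂ (refinement j x))
    card : ∀ (π : Permutation (suc d) (suc d)) i → ∣ (b ∘ (π ⟨$⟩ʳ_)) ⁻¹[ i ] ∣ ≡ a i
    card π i = trans (∣⁻¹∣≡sum (b ∘ (π ⟨$⟩ʳ_)) i)
      (trans (sym (sum-permute (χ i ∘ b) π)) (sum-b d≡ i))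

-- Rational sequences

ι : ℕ → ℚ
ι zero    = 0ℚ
ι (suc n) = 1ℚ ℚ.+ ι n

ι-+ : ∀ m n → ι (m + n) ≡ ι m ℚ.+ ι n
ι-+ zero    n = sym (ℚₚ.+-identityˡ (ι n))
ι-+ (suc m) n = trans (cong (1ℚ ℚ.+_) (ι-+ m n)) (sym (ℚₚ.+-assoc 1ℚ (ι m) (ι n)))

ι-* : ∀ m n → ι (m * n) ≡ ι m ℚ.* ι n
ι-* zero    n = sym (ℚₚ.*-zeroˡ (ι n))
ι-* (suc m) n = begin
  ι (n + m * n)                 ≡⟨ ι-+ n (m * n) ⟩
  ι n ℚ.+ ι (m * n)             ≡⟨ cong₂ ℚ._+_ (sym (ℚₚ.*-identityˡ (ι n))) (ι-* m n) ⟩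
  1ℚ ℚ.* ι n ℚ.+ ι m ℚ.* ι n    ≡⟨ ℚₚ.*-distribʳ-+ (ι n) 1ℚ (ι m) ⟨
  (1ℚ ℚ.+ ι m) ℚ.* ι n          ∎
  where open ≡-Reasoning

0≤ι : ∀ n → 0ℚ ℚ.≤ ι n
0≤ι zero    = ℚₚ.≤-refl
0≤ι (suc n) = ℚₚ.+-mono-≤ (ℚₚ.nonNegative⁻¹ 1ℚ) (0≤ι n)

ι-mono : ∀ {m n} → m ≤ n → ι m ℚ.≤ ι n
ι-mono {n = n} z≤n = 0≤ι n
ι-mono (s≤s m≤n)   = ℚₚ.+-monoʳ-≤ 1ℚ (ι-mono m≤n)

ι-pos : ∀ n → ℚ.Positive (ι (suc n))
ι-pos n = positive (ℚₚ.+-mono-<-≤ (ℚₚ.positive⁻¹ 1ℚ) (0≤ι n))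

*-mono : ∀ {p q r} → 0ℚ ℚ.≤ r → p ℚ.≤ q → p ℚ.* r ℚ.≤ q ℚ.* r
*-mono {r = r} 0≤r = ℚₚ.*-monoʳ-≤-nonNeg r {{nonNegative 0≤r}}

-- Shifted by one: recip k is 1 / (k + 1), and frac k u is u / (k + 1).
recip : ℕ → ℚ
recip k = 1/_ (ι (suc k)) {{ℚₚ.pos⇒nonZero (ι (suc k)) {{ι-pos k}}}}

ι*recip : ∀ k → ι (suc k) ℚ.* recip k ≡ 1ℚ
ι*recip k = ℚₚ.*-inverseʳ (ι (suc k)) {{ℚₚ.pos⇒nonZero (ι (suc k)) {{ι-pos k}}}}

0≤recip : ∀ k → 0ℚ ℚ.≤ recip k
0≤recip k = ℚₚ.<⇒≤ (ℚₚ.positive⁻¹ (recip k) {{ℚₚ.1/pos⇒pos (ι (suc k)) {{ι-pos k}}}})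

frac : ℕ → ℕ → ℚ
frac k u = ι u ℚ.* recip k

toℚᵘ-ι : ∀ n → toℚᵘ (ι n) ℚᵘ.≃ ℚᵘ.mkℚᵘ (ℤ.+ n) 0
toℚᵘ-ι zero    = ℚᵘₚ.≃-refl
toℚᵘ-ι (suc n) = ℚᵘₚ.≃-trans (ℚₚ.toℚᵘ-homo-+ 1ℚ (ι n))
  (ℚᵘₚ.≃-trans (ℚᵘₚ.+-congʳ (toℚᵘ 1ℚ) (toℚᵘ-ι n))
    (ℚᵘ.*≡* (cong (λ i → (ℤ.+ 1 ℤ.+ i) ℤ.* ℤ.+ 1) (ℤₚ.*-identityʳ (ℤ.+ n)))))

-- Multiplying by the denominator leaves a positive numerator; the constructor stores that
-- denominator as `q`, less one.
archimedean : ∀ e → 0ℚ ℚ.< e → ∃[ q ] 1ℚ ℚ.≤ ι (suc q) ℚ.* e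
archimedean (mkℚ (ℤ.+ 0)      _ _) (ℚ.*<* (ℤ.+<+ ()))
archimedean e@(mkℚ ℤ.+[1+ p ] q _) 0<e = q , ℚₚ.toℚᵘ-cancel-≤
  (ℚᵘₚ.≤-respʳ-≃ (ℚᵘₚ.≃-sym (ℚᵘₚ.≃-trans (ℚₚ.toℚᵘ-homo-* (ι (suc q)) e) (ℚᵘₚ.*-congʳ {toℚᵘ e} (toℚᵘ-ι (suc q)))))
    (ℚᵘ.*≤* (ℤ.+≤+ (subst₂ _≤_
      (sym (trans (ℕₚ.*-identityˡ (1 * suc q)) (ℕₚ.*-identityˡ (suc q))))
      (sym (ℕₚ.*-identityʳ (suc q * suc p)))
      (ℕₚ.m≤m*n (suc q) (suc p))))))
archimedean (mkℚ ℤ.-[1+ _ ]   _ _) (ℚ.*<* ())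

frac→0 : ∀ C {e} → 0ℚ ℚ.< e → Eventually λ k → frac k C ℚ.≤ e
frac→0 C {e} 0<e = let q , 1≤ = archimedean e 0<e in C * suc q , λ k large →
  let instance _ = ι-pos k
      open ℚₚ.≤-Reasoning
  in ℚₚ.*-cancelʳ-≤-pos (ι (suc k)) (begin
    (ι C ℚ.* recip k) ℚ.* ι (suc k)
      ≡⟨ trans (ℚₚ.*-assoc (ι C) (recip k) (ι (suc k)))
           (cong (ι C ℚ.*_) (trans (ℚₚ.*-comm (recip k) (ι (suc k))) (ι*recip k))) ⟩
    ι C ℚ.* 1ℚ
      ≤⟨ ℚₚ.*-monoˡ-≤-nonNeg (ι C) {{nonNegative (0≤ι C)}} 1≤ ⟩
    ι C ℚ.* (ι (suc q) ℚ.* e)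
      ≡⟨ trans (sym (ℚₚ.*-assoc (ι C) (ι (suc q)) e)) (cong (ℚ._* e) (sym (ι-* C (suc q)))) ⟩
    ι (C * suc q) ℚ.* e
      ≤⟨ *-mono (ℚₚ.<⇒≤ 0<e) (ι-mono (ℕₚ.m≤n⇒m≤1+n large)) ⟩
    ι (suc k) ℚ.* e
      ≡⟨ ℚₚ.*-comm (ι (suc k)) e ⟩
    e ℚ.* ι (suc k) ∎)

∣-∣-≤ : ∀ {p q w} → p ℚ.≤ q ℚ.+ w → q ℚ.≤ p ℚ.+ w → ℚ.∣ p ℚ.- q ∣ ℚ.≤ w
∣-∣-≤ {p} {q} {w} p≤ q≤ with ℚₚ.∣p∣≡p∨∣p∣≡-p (p ℚ.- q)
... | inj₁ eq = subst₂ ℚ._≤_ (sym eq)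
  (solve 2 (λ q w → q :+ w :- q := w) refl q w) (ℚₚ.+-monoˡ-≤ (ℚ.- q) p≤)
  where open +-*-Solver
... | inj₂ eq = subst₂ ℚ._≤_
  (trans (solve 2 (λ p q → q :- p := :- (p :- q)) refl p q) (sym eq))
  (solve 2 (λ p w → p :+ w :- p := w) refl p w) (ℚₚ.+-monoˡ-≤ (ℚ.- p) q≤)
  where open +-*-Solver

half : ℚ → ℚ
half w = ½ ℚ.* w

half+half : ∀ w → half w ℚ.+ half w ≡ w
half+half w = trans (sym (ℚₚ.*-distribʳ-+ w ½ ½)) (ℚₚ.*-identityˡ w)

0<half : ∀ {e} → 0ℚ ℚ.< e → 0ℚ ℚ.< half e
0<half {e} 0<e = ℚₚ.positive⁻¹ (half e) {{ℚₚ.pos*pos⇒pos ½ e {{positive 0<e}}}}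

half< : ∀ {e} → 0ℚ ℚ.< e → half e ℚ.< e
half< {e} 0<e = subst₂ ℚ._<_ (ℚₚ.+-identityʳ (half e)) (half+half e) (ℚₚ.+-monoʳ-< (half e) (0<half 0<e))

width : ℕ → ℚ
width zero    = 1ℚ
width (suc p) = half (width p)

0<width : ∀ p → 0ℚ ℚ.< width p
0<width zero    = ℚₚ.positive⁻¹ 1ℚ
0<width (suc p) = 0<half (0<width p)

-- Powers of two outgrow `p + 1`, since `p + 2` is at most twice `p + 1`.
ι*width≤1 : ∀ p → ι (suc p) ℚ.* width p ℚ.≤ 1ℚ
ι*width≤1 zero    = ℚₚ.≤-refl
ι*width≤1 (suc p) = begin
  ι (suc (suc p)) ℚ.* half (width p)
    ≤⟨ *-mono (ℚₚ.<⇒≤ (0<width (suc p))) (ℚₚ.+-monoˡ-≤ (ι (suc p)) (ι-mono {1} {suc p} (s≤s z≤n))) ⟩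
  (ι (suc p) ℚ.+ ι (suc p)) ℚ.* half (width p)
    ≡⟨ solve 2 (λ a w → (a :+ a) :* w := a :* (w :+ w)) refl (ι (suc p)) (half (width p)) ⟩
  ι (suc p) ℚ.* (half (width p) ℚ.+ half (width p))
    ≡⟨ cong (ι (suc p) ℚ.*_) (half+half (width p)) ⟩
  ι (suc p) ℚ.* width p
    ≤⟨ ι*width≤1 p ⟩
  1ℚ ∎
  where
  open ℚₚ.≤-Reasoning
  open +-*-Solver

width→0 : ∀ {e} → 0ℚ ℚ.< e → ∃[ p ] width p ℚ.≤ e
width→0 {e} 0<e = let q , 1≤ = archimedean e 0<e in q ,
  ℚₚ.*-cancelˡ-≤-pos (ι (suc q)) {{ι-pos q}} (ℚₚ.≤-trans (ι*width≤1 q) 1≤)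

-- Bolzano-Weierstrass by bisection

em-lower : ExcludedMiddle ℓ → ExcludedMiddle 0ℓ
em-lower {ℓ} em {P} with em {Lift ℓ P}
... | yes (lift p) = yes p
... | no ¬p        = no (¬p ∘ lift)

Frequently : Pred ℕ ℓ → Set ℓ
Frequently P = ∀ N → ∃[ k ] (N ≤ k × P k)

module _ (em : ExcludedMiddle 0ℓ) where

  frequently-⊎ : {P Q : Pred ℕ 0ℓ} → Frequently (λ k → P k ⊎ Q k) → Frequently P ⊎ Frequently Q
  frequently-⊎ {P} {Q} freq with em {∃[ N ] (∀ k → N ≤ k → ¬ P k)}
  ... | yes (N , ¬P) = inj₂ λ M → right M (freq (N ⊔ M))
    where
    right : ∀ M → ∃[ k ] (N ⊔ M ≤ k × (P k ⊎ Q k)) → ∃[ k ] (M ≤ k × Q k)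
    right M (k , le , inj₁ p) = contradiction p (¬P k (ℕₚ.m⊔n≤o⇒m≤o N M le))
    right M (k , le , inj₂ q) = k , ℕₚ.m⊔n≤o⇒n≤o N M le , q
  ... | no always    = inj₁ λ M → left M
    where
    left : ∀ M → ∃[ k ] (M ≤ k × P k)
    left M with em {∃[ k ] (M ≤ k × P k)}
    ... | yes found = found
    ... | no  none  = contradiction (M , λ k M≤k p → none (k , M≤k , p)) always

  module Bisection (u : ℕ → ℚ) (0≤u : ∀ k → 0ℚ ℚ.≤ u k) (u≤1 : ∀ k → u k ℚ.≤ 1ℚ) where

    In : ℚ → ℚ → Pred ℕ 0ℓ
    In a w k = a ℚ.≤ u k × u k ℚ.≤ a ℚ.+ w

    Stage : ℕ → Set
    Stage p = ∃[ a ] Frequently (In a (width p))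

    bisect : ∀ p → (s : Stage p) → Σ[ s′ ∈ Stage (suc p) ]
      (proj₁ s ℚ.≤ proj₁ s′ × proj₁ s′ ℚ.+ width (suc p) ℚ.≤ proj₁ s ℚ.+ width p)
    bisect p (a , freq) with frequently-⊎ {In a w} {In (a ℚ.+ w) w} (λ N → split (freq N))
      where
      w = half (width p)
      split : ∀ {N} → ∃[ k ] (N ≤ k × In a (width p) k) → ∃[ k ] (N ≤ k × (In a w k ⊎ In (a ℚ.+ w) w k))
      split (k , N≤k , a≤ , ≤a) with ℚₚ.≤-total (u k) (a ℚ.+ w)
      ... | inj₁ le = k , N≤k , inj₁ (a≤ , le)
      ... | inj₂ ge = k , N≤k , inj₂ (ge , subst (u k ℚ.≤_)
        (trans (cong (a ℚ.+_) (sym (half+half (width p)))) (sym (ℚₚ.+-assoc a w w))) ≤a)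
    ... | inj₁ low  = (a , low) , ℚₚ.≤-refl ,
      ℚₚ.+-monoʳ-≤ a (ℚₚ.<⇒≤ (half< (0<width p)))
    ... | inj₂ high = (a ℚ.+ half (width p) , high) ,
      subst (ℚ._≤ a ℚ.+ half (width p)) (ℚₚ.+-identityʳ a) (ℚₚ.+-monoʳ-≤ a (ℚₚ.<⇒≤ (0<half (0<width p)))) ,
      ℚₚ.≤-reflexive (trans (ℚₚ.+-assoc a _ _) (cong (a ℚ.+_) (half+half (width p))))

    stage : ∀ p → Stage p
    stage zero    = 0ℚ , λ N → N , ℕₚ.≤-refl , 0≤u N ,
      subst (u N ℚ.≤_) (sym (ℚₚ.+-identityˡ 1ℚ)) (u≤1 N)
    stage (suc p) = proj₁ (bisect p (stage p))

    lower : ℕ → ℚ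
    lower p = proj₁ (stage p)

    lower-mono : ∀ p r → lower p ℚ.≤ lower (r + p)
    lower-mono p zero    = ℚₚ.≤-refl
    lower-mono p (suc r) = ℚₚ.≤-trans (lower-mono p r) (proj₁ (proj₂ (bisect (r + p) (stage (r + p)))))

    upper-mono : ∀ p r → lower (r + p) ℚ.+ width (r + p) ℚ.≤ lower p ℚ.+ width p
    upper-mono p zero    = ℚₚ.≤-refl
    upper-mono p (suc r) = ℚₚ.≤-trans (proj₂ (proj₂ (bisect (r + p) (stage (r + p))))) (upper-mono p r)

    -- A visit to the interval of stage `p`, chosen separately for each `p`. It need not be
    -- monotone: nestedness of the intervals gives the Cauchy property, and `p ≤ φ p` sends the
    -- indices to infinity.
    φ : ℕ → ℕ
    φ p = proj₁ (proj₂ (stage p) p)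

    φ-inflationary : ∀ p → p ≤ φ p
    φ-inflationary p = proj₁ (proj₂ (proj₂ (stage p) p))

    φ-in : ∀ p q → p ≤ q → In (lower p) (width p) (φ q)
    φ-in p q p≤q with a≤ , ≤b ← proj₂ (proj₂ (proj₂ (stage q) q))
                    | eq ← ℕₚ.m∸n+n≡m p≤q =
      ℚₚ.≤-trans (subst (λ q → lower p ℚ.≤ lower q) eq (lower-mono p (q ∸ p))) a≤ ,
      ℚₚ.≤-trans ≤b (subst (λ q → lower q ℚ.+ width q ℚ.≤ lower p ℚ.+ width p) eq (upper-mono p (q ∸ p)))

    cauchy : IsCauchy (u ∘ φ)
    cauchy ε 0<ε = let p , small = width→0 (0<half 0<ε) in p , λ j k p≤j p≤k →
      let a≤uj , uj≤ = φ-in p j p≤j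
          a≤uk , uk≤ = φ-in p k p≤k
      in ℚₚ.≤-<-trans (∣-∣-≤ (ℚₚ.≤-trans uj≤ (ℚₚ.+-mono-≤ a≤uk small))
                             (ℚₚ.≤-trans uk≤ (ℚₚ.+-mono-≤ a≤uj small)))
           (half< 0<ε)

  abstract

    bolzano-weierstrass : ∀ n (u : ℕ → Fin n → ℚ) →
      (∀ k i → 0ℚ ℚ.≤ u k i) → (∀ k i → u k i ℚ.≤ 1ℚ) →
      Σ[ φ ∈ (ℕ → ℕ) ] ((∀ k → k ≤ φ k) × ∀ i → IsCauchy (λ k → u (φ k) i))
    bolzano-weierstrass zero    u 0≤u u≤1 = (λ k → k) , (λ _ → ℕₚ.≤-refl) , λ ()
    bolzano-weierstrass (suc n) u 0≤u u≤1 =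
      let ψ , k≤ψk , ψ-cauchy = bolzano-weierstrass n (λ k → u (φ k) ∘ suc) (λ k → 0≤u (φ k) ∘ suc) (λ k → u≤1 (φ k) ∘ suc)
      in φ ∘ ψ , (λ k → ℕₚ.≤-trans (k≤ψk k) (φ-inflationary (ψ k))) , λ where
        -- The second thinning keeps this coordinate Cauchy because `ψ` never lowers an index.
        zero ε 0<ε → let N , close = cauchy ε 0<ε in N , λ j k N≤j N≤k →
          close (ψ j) (ψ k) (ℕₚ.≤-trans N≤j (k≤ψk j)) (ℕₚ.≤-trans N≤k (k≤ψk k))
        (suc i) → ψ-cauchy i
      where
      open Bisection (λ k → u k zero) (λ k → 0≤u k zero) (λ k → u≤1 k zero)

-- Points of the simplex

0≤frac : ∀ k u → 0ℚ ℚ.≤ frac k u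
0≤frac k u = subst (ℚ._≤ frac k u) (ℚₚ.*-zeroˡ (recip k)) (*-mono (0≤recip k) (0≤ι u))

frac-mono : ∀ k {u v} → u ≤ v → frac k u ℚ.≤ frac k v
frac-mono k u≤v = *-mono (0≤recip k) (ι-mono u≤v)

frac-+ : ∀ k u v → frac k (u + v) ≡ frac k u ℚ.+ frac k v
frac-+ k u v = trans (cong (ℚ._* recip k) (ι-+ u v)) (ℚₚ.*-distribʳ-+ (recip k) (ι u) (ι v))

summand≤sum : ∀ (u : Vector ℕ n) i → u i ≤ sum u
summand≤sum u zero    = ℕₚ.m≤m+n (u zero) _
summand≤sum u (suc i) = ℕₚ.≤-trans (summand≤sum (u ∘ suc) i) (ℕₚ.m≤n+m _ (u zero))

frac≤1 : ∀ k (u : Grid (suc k) n) i → frac k (proj₁ u i) ℚ.≤ 1ℚ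
frac≤1 k (u , sum≡) i = subst (frac k (u i) ℚ.≤_) (ι*recip k)
  (frac-mono k (subst (u i ≤_) sum≡ (summand≤sum u i)))

seq-∑ : ∀ (c : Vector ℝ n) l k u → (∀ i → seq (c i) l ≡ frac k (u i)) → seq (∑ c) l ≡ frac k (sum u)
seq-∑ {zero}  c l k u eq = sym (ℚₚ.*-zeroˡ (recip k))
seq-∑ {suc n} c l k u eq = trans (cong₂ ℚ._+_ (eq zero) (seq-∑ (c ∘ suc) l k (u ∘ suc) (eq ∘ suc)))
  (sym (frac-+ k (u zero) (sum (u ∘ suc))))

∣p-p∣≡0 : ∀ p → ℚ.∣ p ℚ.- p ∣ ≡ 0ℚ
∣p-p∣≡0 p = cong ℚ.∣_∣ (ℚₚ.+-inverseʳ p)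

-- Every term is a grid point, so the coordinates sum to 1 at each index l and not
-- only in the limit.
limit : ∀ (κ : ℕ → ℕ) (u : ∀ l → Grid (suc (κ l)) n) →
  (∀ i → IsCauchy (λ l → frac (κ l) (proj₁ (u l) i))) → Simplex n
coord    (limit κ u cauchy) i = mkℝ (λ l → frac (κ l) (proj₁ (u l) i)) (cauchy i)
coord≥0  (limit κ u cauchy) i ε 0<ε = 0 , λ l _ → ℚₚ.+-mono-≤ (0≤frac (κ l) (proj₁ (u l) i)) (ℚₚ.<⇒≤ 0<ε)
∑coord≈1 (limit κ u cauchy) ε 0<ε = 0 , λ l _ → subst (ℚ._< ε)
  (sym (trans (cong (λ s → ℚ.∣ s ℚ.- 1ℚ ∣)
    (trans (seq-∑ (coord (limit κ u cauchy)) l (κ l) (proj₁ (u l)) (λ _ → refl))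
      (trans (cong (frac (κ l)) (proj₂ (u l))) (ι*recip (κ l))))) (∣p-p∣≡0 1ℚ))) 0<ε

point : ∀ k → Grid (suc k) n → Simplex n
point k u = limit (const k) (const u) λ i → isCauchy (fromℚ (frac k (proj₁ u i)))

-- A rational, non-strict counterpart of `Ball`: radii add up, and for grid points it is an
-- inequality between numerators.
Close : ℚ → Simplex n → Simplex n → Set
Close e s t = ∀ i → Eventually λ k → ℚ.∣ seq (coord s i) k ℚ.- seq (coord t i) k ∣ ℚ.≤ e

eventually-× : {P Q : Pred ℕ ℓ} → Eventually P → Eventually Q → Eventually (λ k → P k × Q k)
eventually-× (M , p) (N , q) = M ⊔ N , λ k le →
  p k (ℕₚ.m⊔n≤o⇒m≤o M N le) , q k (ℕₚ.m⊔n≤o⇒n≤o M N le)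

eventually-∀ : {P : Fin n → Pred ℕ ℓ} → (∀ i → Eventually (P i)) → Eventually (λ k → ∀ i → P i k)
eventually-∀ {zero}  ev = 0 , λ _ _ ()
eventually-∀ {suc n} ev with M , p ← ev zero | N , q ← eventually-∀ (ev ∘ suc) =
  M ⊔ N , λ where
    k le zero    → p k (ℕₚ.m⊔n≤o⇒m≤o M N le)
    k le (suc i) → q k (ℕₚ.m⊔n≤o⇒n≤o M N le) i

close-mono : ∀ {e e′} {s t : Simplex n} → e ℚ.≤ e′ → Close e s t → Close e′ s t
close-mono e≤e′ close i with N , p ← close i = N , λ k le → ℚₚ.≤-trans (p k le) e≤e′

close-trans : ∀ {e e′} {s t r : Simplex n} → Close e s t → Close e′ t r → Close (e ℚ.+ e′) s r
close-trans {s = s} {t} {r} st tr i with N , p ← eventually-× (st i) (tr i) = N , λ k le →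
  let a = seq (coord s i) k
      b = seq (coord t i) k
      c = seq (coord r i) k
  in ℚₚ.≤-trans (ℚₚ.≤-reflexive (cong ℚ.∣_∣ (telescope a b c)))
      (ℚₚ.≤-trans (ℚₚ.∣p+q∣≤∣p∣+∣q∣ (a ℚ.- b) (b ℚ.- c))
        (ℚₚ.+-mono-≤ (proj₁ (p k le)) (proj₂ (p k le))))
  where
  open +-*-Solver
  telescope : ∀ a b c → a ℚ.- c ≡ (a ℚ.- b) ℚ.+ (b ℚ.- c)
  telescope = solve 3 (λ a b c → a :- c := (a :- b) :+ (b :- c)) refl

close-via : ∀ {e} (s t r : Simplex n) → Close (half e) s t → Close (half e) t r → Close e s r
close-via {e = e} s t r st tr =
  subst (λ e → Close e s r) (half+half e) (close-trans {s = s} {t} {r} st tr)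

grid-close : ∀ k C (u v : Grid (suc k) n) →
  (∀ i → proj₁ u i ≤ proj₁ v i + C) → (∀ i → proj₁ v i ≤ proj₁ u i + C) →
  Close (frac k C) (point k u) (point k v)
grid-close k C (u , _) (v , _) u≤ v≤ i = 0 , λ _ _ → ∣-∣-≤
  (subst (frac k (u i) ℚ.≤_) (frac-+ k (v i) C) (frac-mono k (u≤ i)))
  (subst (frac k (v i) ℚ.≤_) (frac-+ k (u i) C) (frac-mono k (v≤ i)))

grid-close-refl : ∀ k C (u : Grid (suc k) n) → Close (frac k C) (point k u) (point k u)
grid-close-refl k C u = grid-close k C u u (λ i → ℕₚ.m≤m+n (proj₁ u i) C) (λ i → ℕₚ.m≤m+n (proj₁ u i) C)

Near : (ℚ → Set ℓ) → Set ℓ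
Near P = ∃[ e ] (0ℚ ℚ.< e × P e)

Antitone : (ℚ → Set ℓ) → Set ℓ
Antitone P = ∀ {e e′} → e ℚ.≤ e′ → P e′ → P e

near-∀ : {P : Fin n → ℚ → Set ℓ} → (∀ i → Antitone (P i)) →
  (∀ i → Near (P i)) → Near (λ e → ∀ i → P i e)
near-∀ {zero}  anti near = 1ℚ , ℚₚ.positive⁻¹ 1ℚ , λ ()
near-∀ {suc n} anti near with e , 0<e , p ← near zero
                            | e′ , 0<e′ , q ← near-∀ (anti ∘ suc) (near ∘ suc)
                            | ℚₚ.≤-total e e′
... | inj₁ e≤e′ = e , 0<e , λ { zero → p ; (suc i) → anti (suc i) e≤e′ (q i) }
... | inj₂ e′≤e = e′ , 0<e′ , λ { zero → anti zero e′≤e p ; (suc i) → q i }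

Within : Simplex n → Pred (Simplex n) ℓ → ℚ → Set ℓ
Within s U e = ∀ t → Close e s t → t ∈ U

within-antitone : ∀ {s} {U : Pred (Simplex n) ℓ} → Antitone (Within s U)
within-antitone {s = s} e≤e′ within t close = within t (close-mono {s = s} {t} e≤e′ close)

open⇒within : {U : Pred (Simplex n) ℓ} → IsOpen U → ∀ s → s ∈ U → Near (Within s U)
open⇒within isOpen s s∈U with ε , (δ , 0<δ , M , δ≤ε) , ball ← isOpen s s∈U =
  -- `δ` is the rational gap that witnesses `0ℝ < ε`. One half serves as radius, the other is the
  -- gap that the strict inequality of `Ball` demands.
  half δ , 0<half 0<δ , λ t close → ball t λ i → half δ , 0<half 0<δ ,
    M ⊔ proj₁ (close i) , λ k le → ℚₚ.≤-trans
      (ℚₚ.+-monoˡ-≤ (half δ) (proj₂ (close i) k (ℕₚ.m⊔n≤o⇒n≤o M _ le)))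
      (ℚₚ.≤-trans (ℚₚ.≤-reflexive (trans (half+half δ) (sym (ℚₚ.+-identityˡ δ))))
        (δ≤ε k (ℕₚ.m⊔n≤o⇒m≤o M _ le)))

-- Cluster points; the closed and the open case

module _ {ℓ} (em : ExcludedMiddle ℓ) where

  cluster : ∀ (u : ∀ k → Grid (suc k) n) → Σ[ φ ∈ (ℕ → ℕ) ] ((∀ k → k ≤ φ k) ×
    ∃[ x ] (∀ {e} → 0ℚ ℚ.< e → Eventually λ k → Close e x (point (φ k) (u (φ k)))))
  cluster {n} u =
    let φ , k≤φk , cauchy = bolzano-weierstrass (em-lower em) n
          (λ k i → frac k (proj₁ (u k) i)) (λ k i → 0≤frac k (proj₁ (u k) i)) (λ k → frac≤1 k (u k))
    in φ , k≤φk , limit φ (u ∘ φ) cauchy , λ {e} 0<e → eventually-∀ λ i →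
      let N , p = cauchy i e 0<e
      -- Here `k` picks the grid point, while `l` runs along the sequence that represents the limit.
      in N , λ k N≤k → N , λ l N≤l → ℚₚ.<⇒≤ (p l k N≤l N≤k)

  abstract

    cluster-near : ∀ C (u : ∀ k → Grid (suc k) n) →
      ∃[ x ] (∀ {e} → 0ℚ ℚ.< e → ∃[ k ] (frac k C ℚ.≤ half e × Close (half e) x (point k (u k))))
    cluster-near C u =
      let φ , k≤φk , x , near = cluster u in x , λ {e} 0<e →
        let M , p = near (0<half 0<e)
            N , q = frac→0 C (0<half 0<e)
            K = M ⊔ N
        in φ K , q (φ K) (ℕₚ.≤-trans (ℕₚ.m≤n⊔m M N) (k≤φk K)) , p K (ℕₚ.m≤m⊔n M N)

  Selection : (A : Fin n → Fin m → Pred (Simplex n) ℓ) → (a : Fin n → ℕ) → Set ℓ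
  Selection {n} {m} A a = Σ[ σ ∈ (Fin m → Fin n) ]
    ((∀ i → ∣ σ ⁻¹[ i ] ∣ ≡ a i) × ∃[ x ] (∀ j → x ∈ A (σ j) j))

  module _ {n d} (a : Fin n → ℕ) (d≡ : suc d ≡ sum a)
    (A : Fin n → Fin (suc d) → Pred (Simplex n) ℓ)
    (avoid : ∀ i j x → x ∈ ∂ i → x ∉ A i j) (cover : ∀ j x → ∃[ i ] (x ∈ A i j)) where

    private
      C = suc d * suc d

    in-A⇒≢0 : ∀ {k} (u : Grid (suc k) n) {i j} → point k u ∈ A i j → proj₁ u i ≢ 0
    in-A⇒≢0 {k} u {i} {j} u∈A ui≡0 = avoid i j (point k u)
      (λ ε 0<ε → 0 , λ _ _ → subst (ℚ._< ε) (sym (trans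
        (cong (λ p → ℚ.∣ p ℚ.- 0ℚ ∣) (trans (cong (frac k) ui≡0) (ℚₚ.*-zeroˡ (recip k)))) (∣p-p∣≡0 0ℚ))) 0<ε)
      u∈A

    -- Some radius `e` around the cluster point `x` makes each of the finitely many closed sets
    -- either contain `x` or miss everything within `e` of it. A single selection with all its
    -- points that close to `x` then forces `x` into every chosen set.
    closed-case : (∀ i j → IsClosed (A i j)) → Selection A a
    closed-case closed =
      let x , near-x           = cluster-near C (λ k → w k zero)
          e , 0<e , separated  = near-∀ (λ i e≤ p j → anti x i j e≤ (p j)) λ i → near-∀ (anti x i) (separate x i)
          k , small , x-close  = near-x 0<e
          σ , card , _ , labels , near = selection k
      in σ , card , x , λ j → resolve x (separated (σ j) j)
           (subst (λ i → point k (w k j) ∈ A i j) (labels j) (proj₂ (cover j (point k (w k j)))))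
           (close-via x (point k (w k zero)) (point k (w k j)) x-close
             (close-mono {s = point k (w k zero)} {point k (w k j)} small
               (grid-close k C (w k zero) (w k j) (near zero j) (near j zero))))
      where
      Λ : ∀ k → Fin (suc d) → Grid (suc k) n → Fin n
      Λ k j u = proj₁ (cover j (point k u))
      selection : ∀ k → Σ[ σ ∈ (Fin (suc d) → Fin n) ] ((∀ i → ∣ σ ⁻¹[ i ] ∣ ≡ a i) ×
        Σ[ w ∈ (Fin (suc d) → Grid (suc k) n) ] ((∀ j → Λ k j (w j) ≡ σ j) ×
          (∀ j j′ i → proj₁ (w j) i ≤ proj₁ (w j′) i + C)))
      selection k = sperner-with-multiplicities a d≡ (suc k) (Λ k)
        (λ j u → in-A⇒≢0 u (proj₂ (cover j (point k u))))
      w : ∀ k → Fin (suc d) → Grid (suc k) n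
      w k = proj₁ (proj₂ (proj₂ (selection k)))
      Separated : Simplex n → Fin n → Fin (suc d) → ℚ → Set ℓ
      Separated x i j e = x ∈ A i j ⊎ Within x (∁ (A i j)) e
      separate : ∀ x i j → Near (Separated x i j)
      separate x i j with em {x ∈ A i j}
      ... | yes x∈A = 1ℚ , ℚₚ.positive⁻¹ 1ℚ , inj₁ x∈A
      ... | no  x∉A = let e , 0<e , within = open⇒within (closed i j) x x∉A in e , 0<e , inj₂ within
      anti : ∀ x i j → Antitone (Separated x i j)
      anti x i j e≤ (inj₁ x∈A)    = inj₁ x∈A
      anti x i j e≤ (inj₂ within) = inj₂ (within-antitone {s = x} {∁ (A i j)} e≤ within)
      resolve : ∀ x {e i j t} → Separated x i j e → t ∈ A i j → Close e x t → x ∈ A i j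
      resolve x (inj₁ x∈A)            _   _     = x∈A
      resolve x {t = t} (inj₂ within) t∈A close = contradiction t∈A (within t close)

    -- The radius `frac k C` is the bound on the distance between the points of one selection on
    -- this grid.
    Inside : ∀ k → Grid (suc k) n → Fin n → Fin (suc d) → Set ℓ
    Inside k u i j = Within (point k u) (A i j) (frac k C)

    Bad : ℕ → Set ℓ
    Bad k = ∃[ u ] ∃[ j ] (∀ i → ¬ Inside k u i j)

    -- Bad points on all grids would cluster at some `x`. The offending cover varies with `k`, so
    -- one radius at `x` is taken for all covers at once; it absorbs the ball around a bad point
    -- near `x`.
    lebesgue : (∀ i j → IsOpen (A i j)) → ¬ (∀ k → Bad k)
    lebesgue isOpen bad =
      let x , near-x          = cluster-near C (λ k → proj₁ (bad k))
          index j             = proj₁ (cover j x)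
          e , 0<e , inside    = near-∀ (λ j → within-antitone {s = x} {A (index j) j})
                                  λ j → open⇒within (isOpen (index j) j) x (proj₂ (cover j x))
          k , small , x-close = near-x 0<e
          u , j , outside     = bad k
      in outside (index j) λ t close → inside j t
           (close-via x (point k u) t x-close (close-mono {s = point k u} {t} small close))

    -- Each label names a set containing a whole ball around its grid point. These balls all reach
    -- `w zero`, which is therefore common to the chosen sets.
    open-case : (∀ i j → IsOpen (A i j)) → Selection A a
    open-case isOpen with em {∃[ k ] (¬ Bad k)}
    ... | no  noneGood = contradiction (λ k → bad k em) (lebesgue isOpen)
      where
      bad : ∀ k → Dec (Bad k) → Bad k
      bad k (yes b) = b
      bad k (no ¬b) = contradiction (k , ¬b) noneGood
    ... | yes (k , good) =
      let σ , card , w , labels , near = sperner-with-multiplicities a d≡ (suc k) (λ j u → proj₁ (label j u))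
            (λ j u → in-A⇒≢0 u (proj₂ (label j u) (point k u) (grid-close-refl k C u)))
      in σ , card , point k (w zero) , λ j →
        subst (λ i → point k (w zero) ∈ A i j) (labels j)
          (proj₂ (label j (w j)) (point k (w zero))
            (grid-close k C (w j) (w zero) (near j zero) (near zero j)))
      where
      label : ∀ j u → ∃[ i ] Inside k u i j
      label j u with em {∃[ i ] Inside k u i j}
      ... | yes found = found
      ... | no  none  = contradiction (u , j , λ i inside → none (i , inside)) good

corollary2 : ∀ {ℓ : Level} → ExcludedMiddle ℓ →
    ∀ (n m : ℕ) → .{{_ : NonZero n}} → .{{_ : NonZero m}} →
    (A : Fin n → Fin m → Pred (Simplex n) ℓ) →
    (∀ i j → IsOpen (A i j)) ⊎ (∀ i j → IsClosed (A i j)) →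
    (∀ i j x → x ∈ ∂ i → x ∉ A i j) →
    (∀ j x → ∃[ i ] (x ∈ A i j)) →
    (a : Fin n → ℕ) → (∀ i → 0 < a i) → sum a ≡ m →
    ∃[ σ ] ((∀ i → ∣ σ ⁻¹[ i ] ∣ ≡ a i) × ∃[ x ] (∀ j → x ∈ A (σ j) j))
corollary2 em n (suc d) A (inj₁ isOpen)   avoid cover a _ sum≡ = open-case em a (sym sum≡) A avoid cover isOpen
corollary2 em n (suc d) A (inj₂ isClosed) avoid cover a _ sum≡ = closed-case em a (sym sum≡) A avoid cover isClosed
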